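{- Let $k$ be a positive integer. For integers $q\ge 2$ define \[ f_k(q) = \min \{ |A-A| : A\subset \mathbb{Z}_q,\ kA = \mathbb{Z}_q \}, \] \[ g_k(q) = \min \{ |A-A| : A\subset \mathbb{Z} \text{ finite},\ kA \supset \{a+1, \ldots, a+q \} \text{ for some integer } a \}, \] \[ h_k(q) = \min \{ |A-A| : A\subset \mathbb{Z} \text{ finite},\ |kA| \geq q \}, \] and put $\beta_k = \inf_{q\geq 2} \frac{\log g_k(q)}{\log q}$. Then the limits as $q\to\infty$ of $\frac{\log f_k(q)}{\log q}$, $\frac{\log g_k(q)}{\log q}$, $\frac{\log h_k(q)}{\log q}$ exist and \[ \lim_{q\to\infty} \frac{\log f_k(q)}{\log q} = \lim_{q\to\infty} \frac{\log g_k(q)}{\log q} = \lim_{q\to\infty} \frac{\log h_k(q)}{\log q} = \inf_{q\geq 2} \frac{\log h_k(q)}{\log q} = \beta_k. \]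
   Context: $\mathbb{Z}_q$ denotes the group of residues modulo $q$. For a set $A$ in an abelian group, $kA = A+\cdots+A$ ($k$ times) is the set of all sums of $k$ elements of $A$, and $A-A=\{a-b: a,b\in A\}$. -}

module Defs where

open import Data.Nat as ℕ using (ℕ; _≤_; _<_; _^_)
open import Data.Integer as ℤ using (ℤ; +_)
open import Data.Fin using (Fin; toℕ)
open import Data.List using (List; length; map)
open import Data.List.Membership.Propositional using (_∈_)
open import Data.List.Relation.Unary.All using (All)
open import Data.List.Relation.Unary.Unique.Propositional using (Unique)
open import Data.Product using (Σ; ∃; ∃-syntax; _×_)
open import Function.Bundles using (_⇔_)
open import Relation.Binary.PropositionalEquality using (_≡_)

HasSize : {X : Set} → (X → Set) → ℕ → Set
HasSize {X} P m =
  Σ (List X) λ xs → Unique xs × (∀ x → (x ∈ xs) ⇔ P x) × length xs ≡ m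

IsMin : (ℕ → Set) → ℕ → Set
IsMin S m = S m × (∀ m′ → S m′ → m ≤ m′)

sumℕ : List ℕ → ℕ
sumℕ = Data.List.foldr ℕ._+_ 0

sumℤ : List ℤ → ℤ
sumℤ = Data.List.foldr ℤ._+_ (+ 0)

-- ℤ_q, with residues represented by Fin q; finite subsets by lists

ModEq : ℕ → ℕ → ℕ → Set
ModEq q x y = ∃[ i ] ∃[ j ] x ℕ.+ i ℕ.* q ≡ y ℕ.+ j ℕ.* q

InSumsetZq : (q k : ℕ) → List (Fin q) → Fin q → Set
InSumsetZq q k A x =
  ∃[ v ] length v ≡ k × All (_∈ A) v × ModEq q (sumℕ (map toℕ v)) (toℕ x)

InDiffZq : (q : ℕ) → List (Fin q) → Fin q → Set
InDiffZq q A d =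
  ∃[ a ] ∃[ b ] a ∈ A × b ∈ A × ModEq q (toℕ d ℕ.+ toℕ b) (toℕ a)

InSumsetℤ : (k : ℕ) → List ℤ → ℤ → Set
InSumsetℤ k A x = ∃[ v ] length v ≡ k × All (_∈ A) v × sumℤ v ≡ x

InDiffℤ : List ℤ → ℤ → Set
InDiffℤ A d = ∃[ a ] ∃[ b ] a ∈ A × b ∈ A × d ≡ a ℤ.- b

IsF : (k q m : ℕ) → Set
IsF k q = IsMin λ m → ∃[ A ]
  (∀ x → InSumsetZq q k A x) × HasSize (InDiffZq q A) m

IsG : (k q m : ℕ) → Set
IsG k q = IsMin λ m → ∃[ A ]
  (∃[ a ] ∀ (i : ℕ) → 1 ≤ i → i ≤ q → InSumsetℤ k A (a ℤ.+ + i))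
  × HasSize (InDiffℤ A) m

IsH : (k q m : ℕ) → Set
IsH k q = IsMin λ m → ∃[ A ]
  (∃[ n ] HasSize (InSumsetℤ k A) n × q ≤ n)
  × HasSize (InDiffℤ A) m

-- Real-valued quantities log F(q) / log q encoded via comparisons with
-- nonnegative rationals r/s (s ≥ 1), for q ≥ 2:
--   log x / log q < r/s  ⇔  x^s < q^r
--   log x / log q ≥ r/s  ⇔  q^r ≤ x^s
-- (All ratios are ≥ 0, so nonnegative rationals suffice.)

InfAtLeast : (ℕ → ℕ) → (r s : ℕ) → Set
InfAtLeast G r s = ∀ q → 2 ≤ q → q ^ r ≤ G q ^ s

InfBelow : (ℕ → ℕ) → (r s : ℕ) → Set
InfBelow G r s = ∃[ q ] 2 ≤ q × G q ^ s < q ^ r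

-- lim_{q→∞} log F(q)/log q exists and equals inf_{q≥2} log G(q)/log q:
--  * for rationals r/s < r′/s′ ≤ β, eventually log F(q)/log q > r/s
--  * for rationals r/s > β, eventually log F(q)/log q < r/s
LimitIsInf : (F G : ℕ → ℕ) → Set
LimitIsInf F G =
  (∀ r s r′ s′ → 1 ≤ s → 1 ≤ s′ → r ℕ.* s′ < r′ ℕ.* s → InfAtLeast G r′ s′ →
     ∃[ N ] ∀ q → N ≤ q → q ^ r < F q ^ s)
  × (∀ r s → 1 ≤ s → InfBelow G r s →
     ∃[ N ] ∀ q → N ≤ q → F q ^ s < q ^ r)

SameInf : (H G : ℕ → ℕ) → Set
SameInf H G = ∀ r s → 1 ≤ s → InfBelow H r s ⇔ InfBelow G r s

{-# OPTIONS --safe #-}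

-- Write β for the infimum belonging to g.  Combining digits in base q gives
-- g(qq′) ≤ g(q) g(q′), so log g / log q tends to its infimum β.  Reducing a set
-- modulo q gives f ≤ g; conversely, replacing a set of residues A by A ∪ (A − q)
-- turns a cover of ℤ_q into a cover of an interval of length q, so g ≤ 4f.
--
-- Clearly h ≤ g.  The remaining point is that h(q)^s < q^r for one q forces
-- g(Q)^s < Q^r for some Q.  Let |kA| ≥ q and |A − A| = d with d^s < q^r.  In
-- A + c₁A + c₂A + …, the k-fold sumset contains X = S + c₁S + c₂S + … for S ⊆ kA.
-- Two distinct pairs (x, y), (x′, y′) collide under x + cy for at most one c, so
-- some cᵢ below the number of pairs loses at most half of them.  Hence X has
-- positive density, uniformly in the number n of summands, in an interval, while
-- the difference set grows only to dⁿ.  By averaging, O(n) translates of X cover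
-- an interval as long as X is large, and adding their set to the base costs a
-- factor O(n²), which the exponential gap between d^s and q^r absorbs.
module Submission where

open import Defs
open import Data.Nat as ℕ using (ℕ; zero; suc; _+_; _*_; _^_; _∸_; _≤_; _<_; z≤n; s≤s; NonZero)
import Data.Nat.DivMod as ℕ
import Data.Nat.Properties as ℕₚ
import Data.Nat.Tactic.RingSolver as ℕRing
open import Data.Integer as ℤ using (ℤ; +_; -[1+_]; ∣_∣)
import Data.Integer.DivMod as ℤ
import Data.Integer.Properties as ℤₚ
import Data.Integer.Tactic.RingSolver as ℤRing
open import Algebra.Bundles using (module AbelianGroup)
import Algebra.Properties.Group (AbelianGroup.group ℤₚ.+-0-abelianGroup) as ℤGroup
open import Data.Fin using (Fin; toℕ; fromℕ<)
import Data.Fin.Properties as Finₚ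
open import Data.List using
  ( List; []; _∷_; _++_; length; map; filter; take; upTo; applyUpTo; replicate
  ; cartesianProduct; cartesianProductWith; deduplicate)
open import Data.List.Properties using
  (length-map; length-++; length-take; take++drop≡id; length-upTo; length-replicate)
open import Data.List.Membership.Propositional using (_∈_)
open import Data.List.Membership.Propositional.Properties using
  ( ∈-map⁺; ∈-map⁻; ∈-filter⁺; ∈-filter⁻; ∈-∃++; ∈-++⁻; ∈-++⁺ˡ; ∈-++⁺ʳ; ∈-upTo⁺; ∈-upTo⁻
  ; ∈-cartesianProductWith⁺; ∈-cartesianProductWith⁻; ∈-cartesianProduct⁻
  ; ∈-deduplicate⁺; ∈-deduplicate⁻)
import Data.List.Membership.DecPropositional as DecMembership
open import Data.List.Relation.Unary.All as All using (All; []; _∷_)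
import Data.List.Relation.Unary.All.Properties as Allₚ
open import Data.List.Relation.Unary.AllPairs using ([]; _∷_)
open import Data.List.Relation.Unary.Any using (here; there)
open import Data.List.Relation.Unary.Unique.Propositional using (Unique)
import Data.List.Relation.Unary.Unique.Propositional.Properties as Unique
import Data.List.Relation.Unary.Unique.DecPropositional.Properties as DecUnique
open import Data.Product using (∃-syntax; _×_; _,_; proj₁; proj₂)
open import Data.Sum using (_⊎_; inj₁; inj₂)
open import Function using (_∘_; case_of_)
open import Function.Bundles using (_⇔_; mk⇔; Equivalence)
open import Relation.Binary.Definitions using (DecidableEquality)
open import Relation.Binary.PropositionalEquality
open import Relation.Nullary using (Dec; yes; no; contradiction)
open import Relation.Nullary.Decidable using (¬?)
open import Relation.Unary using (Decidable)

open Equivalence using (to; from)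

private variable
  X Y Z : Set

-- Counting in lists

Unique-⊆⇒length≤ : {xs ys : List X} → Unique xs → (∀ {x} → x ∈ xs → x ∈ ys) →
                   length xs ≤ length ys
Unique-⊆⇒length≤ {xs = []} _ _ = z≤n
Unique-⊆⇒length≤ {xs = x ∷ xs} u@(_ ∷ u′) sub with ∈-∃++ (sub (here refl))
... | ps , qs , refl = begin
  suc (length xs)           ≤⟨ s≤s (Unique-⊆⇒length≤ u′ sub′) ⟩
  suc (length (ps ++ qs))   ≡⟨ cong suc (length-++ ps) ⟩
  suc (length ps + length qs) ≡⟨ ℕₚ.+-suc (length ps) (length qs) ⟨
  length ps + suc (length qs) ≡⟨ length-++ ps ⟨
  length (ps ++ x ∷ qs)     ∎
  where
  open ℕₚ.≤-Reasoning
  sub′ : ∀ {y} → y ∈ xs → y ∈ ps ++ qs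
  sub′ y∈xs with ∈-++⁻ ps (sub (there y∈xs))
  ... | inj₁ y∈ps = ∈-++⁺ˡ y∈ps
  ... | inj₂ (here refl) = contradiction y∈xs (Unique.Unique[x∷xs]⇒x∉xs u)
  ... | inj₂ (there y∈qs) = ∈-++⁺ʳ ps y∈qs

∑ : List X → (X → ℕ) → ℕ
∑ []       f = 0
∑ (x ∷ xs) f = f x + ∑ xs f

∑-mono : (xs : List X) {f g : X → ℕ} → (∀ x → x ∈ xs → f x ≤ g x) → ∑ xs f ≤ ∑ xs g
∑-mono []       f≤g = z≤n
∑-mono (x ∷ xs) f≤g = ℕₚ.+-mono-≤ (f≤g x (here refl)) (∑-mono xs λ y → f≤g y ∘ there)

∑-const : (xs : List X) (c : ℕ) → ∑ xs (λ _ → c) ≡ length xs * c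
∑-const []       c = refl
∑-const (x ∷ xs) c = cong (_+_ c) (∑-const xs c)

∑-+ : (xs : List X) (f g : X → ℕ) → ∑ xs (λ x → f x + g x) ≡ ∑ xs f + ∑ xs g
∑-+ []       f g = refl
∑-+ (x ∷ xs) f g rewrite ∑-+ xs f g = interchange (f x) (g x) (∑ xs f) (∑ xs g)
  where
  interchange : ∀ a b c d → (a + b) + (c + d) ≡ (a + c) + (b + d)
  interchange = ℕRing.solve-∀

∑-swap : (xs : List X) (ys : List Y) (f : X → Y → ℕ) →
         ∑ xs (λ x → ∑ ys (f x)) ≡ ∑ ys (λ y → ∑ xs (λ x → f x y))
∑-swap []       ys f = sym (trans (∑-const ys 0) (ℕₚ.*-zeroʳ (length ys)))
∑-swap (x ∷ xs) ys f = trans (cong (_+_ (∑ ys (f x))) (∑-swap xs ys f))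
                             (sym (∑-+ ys (f x) (λ y → ∑ xs (λ x′ → f x′ y))))

-- Averaging with the division by the length cleared. The list has the form `x ∷ xs` because a least
-- value exists only in a nonempty list.
small-term : (x : X) (xs : List X) (f : X → ℕ) →
             ∃[ y ] y ∈ x ∷ xs × length (x ∷ xs) * f y ≤ ∑ (x ∷ xs) f
small-term x []       f = x , here refl , ℕₚ.≤-refl
small-term x (x′ ∷ xs) f with small-term x′ xs f
... | y , y∈ , avg with ℕₚ.≤-total (f x) (f y)
...   | inj₁ fx≤fy = x , here refl ,
        ℕₚ.+-monoʳ-≤ (f x) (ℕₚ.≤-trans (ℕₚ.*-monoʳ-≤ (suc (length xs)) fx≤fy) avg)
...   | inj₂ fy≤fx = y , there y∈ , ℕₚ.+-mono-≤ fy≤fx avg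

large-term : (x : X) (xs : List X) (f : X → ℕ) →
             ∃[ y ] y ∈ x ∷ xs × ∑ (x ∷ xs) f ≤ length (x ∷ xs) * f y
large-term x []       f = x , here refl , ℕₚ.≤-refl
large-term x (x′ ∷ xs) f with large-term x′ xs f
... | y , y∈ , avg with ℕₚ.≤-total (f x) (f y)
...   | inj₁ fx≤fy = y , there y∈ , ℕₚ.+-mono-≤ fx≤fy avg
...   | inj₂ fy≤fx = x , here refl ,
        ℕₚ.+-monoʳ-≤ (f x) (ℕₚ.≤-trans avg (ℕₚ.*-monoʳ-≤ (suc (length xs)) fy≤fx))

𝟙 : {P : Set} → Dec P → ℕ
𝟙 (yes _) = 1
𝟙 (no _)  = 0

module _ {P : X → Set} (P? : Decidable P) where

  length-filter≡∑ : ∀ xs → length (filter P? xs) ≡ ∑ xs (𝟙 ∘ P?)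
  length-filter≡∑ [] = refl
  length-filter≡∑ (x ∷ xs) with P? x
  ... | yes _ = cong suc (length-filter≡∑ xs)
  ... | no _  = length-filter≡∑ xs

  length-filter-¬ : ∀ xs → length (filter (¬? ∘ P?) xs) + ∑ xs (𝟙 ∘ P?) ≡ length xs
  length-filter-¬ [] = refl
  length-filter-¬ (x ∷ xs) with P? x
  ... | yes _ = trans (ℕₚ.+-suc _ _) (cong suc (length-filter-¬ xs))
  ... | no _  = cong suc (length-filter-¬ xs)

  ∑𝟙≤1 : ∀ {xs} → Unique xs → (∀ {x y} → P x → P y → x ≡ y) → ∑ xs (𝟙 ∘ P?) ≤ 1
  ∑𝟙≤1 {xs} u P-prop rewrite sym (length-filter≡∑ xs) with filter P? xs in eq
  ... | [] = z≤n
  ... | y ∷ ys = Unique-⊆⇒length≤ {ys = y ∷ []} (subst Unique eq (Unique.filter⁺ P? u))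
        λ z∈ → here (P-prop (holds z∈) (holds (here refl)))
    where
    holds : ∀ {z} → z ∈ y ∷ ys → P z
    holds z∈ = proj₂ (∈-filter⁻ P? {xs = xs} (subst (_ ∈_) (sym eq) z∈))

  -- Serves the covering argument, where `f x` is `y - x`, the shift that moves the element x of a
  -- part onto y.
  length≤∑𝟙 : ∀ {ys : List Y} xs (f : Y → X) → (∀ {y y′} → f y ≡ f y′ → y ≡ y′) → Unique ys →
              (∀ {y} → y ∈ ys → f y ∈ xs × P (f y)) → length ys ≤ ∑ xs (𝟙 ∘ P?)
  length≤∑𝟙 {ys = ys} xs f inj u hit = begin
    length ys             ≡⟨ length-map f ys ⟨
    length (map f ys)     ≤⟨ Unique-⊆⇒length≤ (Unique.map⁺ inj u) sub ⟩
    length (filter P? xs) ≡⟨ length-filter≡∑ xs ⟩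
    ∑ xs (𝟙 ∘ P?)         ∎
    where
    open ℕₚ.≤-Reasoning
    sub : ∀ {z} → z ∈ map f ys → z ∈ filter P? xs
    sub z∈ with ∈-map⁻ f z∈
    ... | y , y∈ys , refl = ∈-filter⁺ P? (proj₁ (hit y∈ys)) (proj₂ (hit y∈ys))

-- Collisions and the sizes of images

module _ (_≟_ : DecidableEquality Y) where

  collisions : (X → Y) → List X → ℕ
  collisions φ []       = 0
  collisions φ (x ∷ xs) = ∑ xs (λ x′ → 𝟙 (φ x ≟ φ x′)) + collisions φ xs

  -- A value taken m times costs the image m - 1 entries but yields m(m - 1)/2 collisions, at least
  -- as many. In the induction an entry whose value recurs later is paid for by one such collision.
  image-size : (φ : X → Y) (xs : List X) →
    ∃[ ys ] Unique ys × (∀ {y} → y ∈ ys → ∃[ x ] x ∈ xs × y ≡ φ x)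
      × length xs ≤ length ys + collisions φ xs
  image-size φ [] = [] , [] , (λ ()) , z≤n
  image-size φ (x ∷ xs) with image-size φ xs
  ... | ys , u , im , size with DecMembership._∈?_ _≟_ (φ x) ys
  ...   | yes φx∈ys = ys , u , (λ y∈ → let x′ , x′∈ , e = im y∈ in x′ , there x′∈ , e) , (begin
            suc (length xs)                      ≤⟨ s≤s size ⟩
            suc (length ys + collisions φ xs)    ≡⟨ ℕₚ.+-suc _ _ ⟨
            length ys + (1 + collisions φ xs)    ≤⟨ ℕₚ.+-monoʳ-≤ (length ys) (ℕₚ.+-monoˡ-≤ _ (hit xs (proj₂ (im φx∈ys)))) ⟩
            length ys + collisions φ (x ∷ xs)    ∎)
    where
    open ℕₚ.≤-Reasoning
    hit : ∀ zs {z} → z ∈ zs × φ x ≡ φ z → 1 ≤ ∑ zs (λ x′ → 𝟙 (φ x ≟ φ x′))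
    hit (z ∷ zs) (here refl , e) with φ x ≟ φ z
    ... | yes _ = s≤s z≤n
    ... | no ne = contradiction e ne
    hit (z ∷ zs) (there z∈ , e) = ℕₚ.m≤n⇒m≤o+n (𝟙 (φ x ≟ φ z)) (hit zs (z∈ , e))
  ...   | no φx∉ys = φ x ∷ ys , All.tabulate (λ y∈ e → φx∉ys (subst (_∈ ys) (sym e) y∈)) ∷ u
                   , im′ , s≤s (ℕₚ.≤-trans size (ℕₚ.+-monoʳ-≤ (length ys) (ℕₚ.m≤n+m _ _)))
    where
    im′ : ∀ {y} → y ∈ φ x ∷ ys → ∃[ z ] z ∈ x ∷ xs × y ≡ φ z
    im′ (here e)   = x , here refl , e
    im′ (there y∈) = let x′ , x′∈ , e = im y∈ in x′ , there x′∈ , e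

  -- After exchanging the sums, each of the l(l - 1)/2 pairs collides for at most one `c`. The
  -- weaker bound l² suits the induction without subtraction, as l² + 2l + 1 = (l + 1)².
  total-collisions : (φ : Z → X → Y) (cs : List Z) →
    (∀ x x′ → x ≢ x′ → ∑ cs (λ c → 𝟙 (φ c x ≟ φ c x′)) ≤ 1) →
    ∀ {xs} → Unique xs → 2 * ∑ cs (λ c → collisions (φ c) xs) ≤ length xs * length xs
  total-collisions φ cs rare {[]} _ = ℕₚ.≤-reflexive (cong (2 *_) (trans (∑-const cs 0) (ℕₚ.*-zeroʳ (length cs))))
  total-collisions φ cs rare {x ∷ xs} (x∉ ∷ u) = begin
    2 * ∑ cs (λ c → ∑ xs (hit c) + collisions (φ c) xs)
      ≡⟨ cong (2 *_) (∑-+ cs _ _) ⟩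
    2 * (∑ cs (λ c → ∑ xs (hit c)) + ∑ cs (λ c → collisions (φ c) xs))
      ≡⟨ ℕₚ.*-distribˡ-+ 2 (∑ cs (λ c → ∑ xs (hit c))) _ ⟩
    2 * ∑ cs (λ c → ∑ xs (hit c)) + 2 * ∑ cs (λ c → collisions (φ c) xs)
      ≤⟨ ℕₚ.+-mono-≤ (ℕₚ.*-monoʳ-≤ 2 bound) (total-collisions φ cs rare u) ⟩
    2 * l + l * l
      ≤⟨ ℕₚ.n≤1+n _ ⟩
    suc (2 * l + l * l)
      ≡⟨ square l ⟩
    suc l * suc l ∎
    where
    open ℕₚ.≤-Reasoning
    l = length xs
    hit = λ c x′ → 𝟙 (φ c x ≟ φ c x′)
    bound : ∑ cs (λ c → ∑ xs (hit c)) ≤ l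
    bound = begin
      ∑ cs (λ c → ∑ xs (hit c))         ≡⟨ ∑-swap cs xs hit ⟩
      ∑ xs (λ x′ → ∑ cs (λ c → hit c x′)) ≤⟨ ∑-mono xs (λ x′ x′∈ → rare x x′ (All.lookup x∉ x′∈)) ⟩
      ∑ xs (λ _ → 1)                    ≡⟨ ∑-const xs 1 ⟩
      l * 1                             ≡⟨ ℕₚ.*-identityʳ l ⟩
      l                                 ∎
    square : ∀ a → suc (2 * a + a * a) ≡ suc a * suc a
    square = ℕRing.solve-∀

  -- Some `c` has at most l²/(2C) collisions by averaging, where l = `length xs` and C =
  -- `length cs`. The last inequality has this denominator cleared.
  large-image : (φ : Z → X → Y) (c₀ : Z) (cs′ : List Z) → let cs = c₀ ∷ cs′ in
    (∀ x x′ → x ≢ x′ → ∑ cs (λ c → 𝟙 (φ c x ≟ φ c x′)) ≤ 1) →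
    ∀ {xs} → Unique xs →
    ∃[ c ] c ∈ cs × ∃[ ys ] Unique ys × (∀ {y} → y ∈ ys → ∃[ x ] x ∈ xs × y ≡ φ c x)
      × 2 * length cs * length xs ≤ 2 * length cs * length ys + length xs * length xs
  large-image φ c₀ cs′ rare {xs} u
    with small-term c₀ cs′ (λ c → collisions (φ c) xs)
  ... | c , c∈ , few with image-size (φ c) xs
  ...   | ys , u′ , im , size = c , c∈ , ys , u′ , im , (begin
    2 * C * length xs
      ≤⟨ ℕₚ.*-monoʳ-≤ (2 * C) size ⟩
    2 * C * (length ys + collisions (φ c) xs)
      ≡⟨ expand C (length ys) (collisions (φ c) xs) ⟩
    2 * C * length ys + 2 * (C * collisions (φ c) xs)
      ≤⟨ ℕₚ.+-monoʳ-≤ (2 * C * length ys) (ℕₚ.*-monoʳ-≤ 2 few) ⟩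
    2 * C * length ys + 2 * ∑ (c₀ ∷ cs′) (λ c → collisions (φ c) xs)
      ≤⟨ ℕₚ.+-monoʳ-≤ (2 * C * length ys) (total-collisions φ (c₀ ∷ cs′) rare u) ⟩
    2 * C * length ys + length xs * length xs ∎)
    where
    open ℕₚ.≤-Reasoning
    C = length (c₀ ∷ cs′)
    expand : ∀ a b c → 2 * a * (b + c) ≡ 2 * a * b + 2 * (a * c)
    expand = ℕRing.solve-∀

length-cartesianProductWith : (f : X → Y → Z) (xs : List X) (ys : List Y) →
  length (cartesianProductWith f xs ys) ≡ length xs * length ys
length-cartesianProductWith f []       ys = refl
length-cartesianProductWith f (x ∷ xs) ys =
  trans (length-++ (map (f x) ys))
        (cong₂ _+_ (length-map (f x) ys) (length-cartesianProductWith f xs ys))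

∈-take⁻ : ∀ n {xs : List X} {x} → x ∈ take n xs → x ∈ xs
∈-take⁻ n {xs} x∈ = subst (_ ∈_) (take++drop≡id n xs) (∈-++⁺ˡ x∈)

term≤∑ : (xs : List X) (f : X → ℕ) → ∀ {x} → x ∈ xs → f x ≤ ∑ xs f
term≤∑ (x ∷ xs) f (here refl) = ℕₚ.m≤m+n (f x) _
term≤∑ (x ∷ xs) f (there x∈)  = ℕₚ.m≤n⇒m≤o+n (f x) (term≤∑ xs f x∈)

-- Dilated sums of sets of integers

-- The list `D` may repeat entries or hold more than the differences, so bounds multiply without
-- deduplication.
DiffBound : List ℤ → ℕ → Set
DiffBound A d = ∃[ D ] (∀ {a b} → a ∈ A → b ∈ A → a ℤ.- b ∈ D) × length D ≤ d

dilateSum : ℕ → List ℤ → List ℤ → List ℤ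
dilateSum c = cartesianProductWith λ a b → a ℤ.+ + c ℤ.* b

-- (A + cB) - (A + cB) = (A - A) + c(B - B) for every `c`, which leaves `c` free to be chosen for
-- the size of the sumset.
dilateSum-diff : ∀ c {A B d e} → DiffBound A d → DiffBound B e → DiffBound (dilateSum c A B) (d * e)
dilateSum-diff c {A} {B} (D , A-A , |D|) (E , B-B , |E|) =
  dilateSum c D E , diff
  , ℕₚ.≤-trans (ℕₚ.≤-reflexive (length-cartesianProductWith _ D E)) (ℕₚ.*-mono-≤ |D| |E|)
  where
  regroup : ∀ t a b a′ b′ →
    (a ℤ.- a′) ℤ.+ t ℤ.* (b ℤ.- b′) ≡ (a ℤ.+ t ℤ.* b) ℤ.- (a′ ℤ.+ t ℤ.* b′)
  regroup = ℤRing.solve-∀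
  diff : ∀ {x y} → x ∈ dilateSum c A B → y ∈ dilateSum c A B → x ℤ.- y ∈ dilateSum c D E
  diff x∈ y∈ with ∈-cartesianProductWith⁻ _ A B x∈ | ∈-cartesianProductWith⁻ _ A B y∈
  ... | a , b , a∈ , b∈ , refl | a′ , b′ , a′∈ , b′∈ , refl =
    subst (_∈ dilateSum c D E) (regroup (+ c) a b a′ b′)
      (∈-cartesianProductWith⁺ _ (A-A a∈ a′∈) (B-B b∈ b′∈))

-- Both representations have exactly `k` summands, so these can be paired entry by entry.
dilateSum-sumset : ∀ c {A B} k {x y} → InSumsetℤ k A x → InSumsetℤ k B y →
                   InSumsetℤ k (dilateSum c A B) (x ℤ.+ + c ℤ.* y)
dilateSum-sumset c zero ([] , refl , [] , refl) ([] , refl , [] , refl) =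
  [] , refl , [] , sym (trans (ℤₚ.+-identityˡ _) (ℤₚ.*-zeroʳ (+ c)))
dilateSum-sumset c (suc k) (a ∷ v , refl , a∈ ∷ v∈ , refl) (b ∷ w , |w| , b∈ ∷ w∈ , refl)
  with dilateSum-sumset c k (v , refl , v∈ , refl) (w , ℕₚ.suc-injective |w| , w∈ , refl)
... | u , |u| , u∈ , Σu =
  (a ℤ.+ + c ℤ.* b) ∷ u , cong suc |u| , ∈-cartesianProductWith⁺ _ a∈ b∈ ∷ u∈
  , trans (cong (λ z → a ℤ.+ + c ℤ.* b ℤ.+ z) Σu) (regroup (+ c) a b (sumℤ v) (sumℤ w))
  where
  regroup : ∀ t a b x y →
    (a ℤ.+ t ℤ.* b) ℤ.+ (x ℤ.+ t ℤ.* y) ≡ (a ℤ.+ x) ℤ.+ t ℤ.* (b ℤ.+ y)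
  regroup = ℤRing.solve-∀

zero-diff : DiffBound (+ 0 ∷ []) 1
zero-diff = + 0 ∷ [] , (λ { (here refl) (here refl) → here refl }) , ℕₚ.≤-refl

sumℤ-zeros : ∀ k → sumℤ (replicate k (+ 0)) ≡ + 0
sumℤ-zeros zero    = refl
sumℤ-zeros (suc k) = trans (ℤₚ.+-identityˡ _) (sumℤ-zeros k)

zero-sumset : ∀ k {A} → + 0 ∈ A → InSumsetℤ k A (+ 0)
zero-sumset k 0∈ = replicate k (+ 0) , length-replicate k , Allₚ.replicate⁺ k 0∈ , sumℤ-zeros k

-- One summand is `t` and the other k - 1 are zeros; this is where k must be positive.
member-sumset : ∀ k → 1 ≤ k → ∀ {A t} → + 0 ∈ A → t ∈ A → InSumsetℤ k A t
member-sumset (suc k) _ {t = t} 0∈ t∈ =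
  t ∷ replicate k (+ 0) , cong suc (length-replicate k) , t∈ ∷ Allₚ.replicate⁺ k 0∈
  , trans (cong (ℤ._+_ t) (sumℤ-zeros k)) (ℤₚ.+-identityʳ t)

-- A witness of h_k(w) ≤ d that lies in [-R , R].
record SumsetPart (k d w R : ℕ) : Set where
  field
    base      : List ℤ
    part      : List ℤ
    base-diff : DiffBound base d
    unique    : Unique part
    isSum     : ∀ {x} → x ∈ part → InSumsetℤ k base x
    bounded   : ∀ {x} → x ∈ part → ∣ x ∣ ≤ R
    size      : length part ≡ w

open SumsetPart

trim : ∀ {k d d′ w w′ R R′} → d ≤ d′ → w′ ≤ w → R ≤ R′ → SumsetPart k d w R → SumsetPart k d′ w′ R′
trim {w′ = w′} d≤d′ w′≤w R≤R′ P = record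
  { base      = base P
  ; part      = take w′ (part P)
  ; base-diff = let D , A-A , |D| = base-diff P in D , A-A , ℕₚ.≤-trans |D| d≤d′
  ; unique    = Unique.take⁺ w′ (unique P)
  ; isSum     = isSum P ∘ ∈-take⁻ w′
  ; bounded   = λ x∈ → ℕₚ.≤-trans (bounded P (∈-take⁻ w′ x∈)) R≤R′
  ; size      = trans (length-take w′ (part P)) (ℕₚ.m≤n⇒m⊓n≡m (ℕₚ.≤-trans w′≤w (ℕₚ.≤-reflexive (sym (size P)))))
  }

zero-part : ∀ k → SumsetPart k 1 1 0
zero-part k = record
  { base      = + 0 ∷ []
  ; part      = + 0 ∷ []
  ; base-diff = zero-diff
  ; unique    = [] ∷ []
  ; isSum     = λ { (here refl) → zero-sumset k (here refl) }
  ; bounded   = λ { (here refl) → z≤n }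
  ; size      = refl
  }

-- Subtracting the two equations leaves (c - c′)(y - y′) = 0, and y = y′ would give x = x′ by the
-- first equation.
dilation-determined : ∀ (x x′ y y′ c c′ : ℤ) → (x , y) ≢ (x′ , y′) →
  x ℤ.+ c ℤ.* y ≡ x′ ℤ.+ c ℤ.* y′ → x ℤ.+ c′ ℤ.* y ≡ x′ ℤ.+ c′ ℤ.* y′ → c ≡ c′
dilation-determined x x′ y y′ c c′ p≢p′ e e′ =
  ℤₚ.i-j≡0⇒i≡j c c′ (case ℤₚ.i*j≡0⇒i≡0∨j≡0 (c ℤ.- c′) {y ℤ.- y′} product≡0 of λ
    { (inj₁ c-c′≡0) → c-c′≡0
    ; (inj₂ y-y′≡0) → contradiction (equal (ℤₚ.i-j≡0⇒i≡j y y′ y-y′≡0)) p≢p′ })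
  where
  factor : ∀ x y x′ y′ c c′ →
    (c ℤ.- c′) ℤ.* (y ℤ.- y′)
      ≡ ((x ℤ.+ c ℤ.* y) ℤ.- (x′ ℤ.+ c ℤ.* y′)) ℤ.- ((x ℤ.+ c′ ℤ.* y) ℤ.- (x′ ℤ.+ c′ ℤ.* y′))
  factor = ℤRing.solve-∀
  product≡0 : (c ℤ.- c′) ℤ.* (y ℤ.- y′) ≡ + 0
  product≡0 = trans (factor x y x′ y′ c c′)
    (cong₂ ℤ._-_ (ℤₚ.i≡j⇒i-j≡0 {x ℤ.+ c ℤ.* y} e) (ℤₚ.i≡j⇒i-j≡0 {x ℤ.+ c′ ℤ.* y} e′))
  equal : y ≡ y′ → (x , y) ≡ (x′ , y′)
  equal refl = cong (_, y) (ℤGroup.∙-cancelʳ (c ℤ.* y) x x′ e)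

dilate : ℕ → ℤ × ℤ → ℤ
dilate c (x , y) = x ℤ.+ + c ℤ.* y

-- Apply `large-image` to the pairs from the two parts, with the `C` dilation factors below `C`. The
-- loss is at most (w w′)²/(2C).
dilateSum-part : ∀ {k d d′ w w′ R R′} → SumsetPart k d w R → SumsetPart k d′ w′ R′ →
  ∀ C .{{_ : NonZero C}} →
  ∃[ w″ ] 2 * C * (w * w′) ≤ 2 * C * w″ + (w * w′) * (w * w′)
    × SumsetPart k (d * d′) w″ (R + C * R′)
dilateSum-part {k} {w = w} {w′} {R} {R′} P Q (suc C) =
  let c , c∈ , ys , u , im , large =
        -- The factors are `upTo (suc C)` with its head 0 split off.
        large-image ℤₚ._≟_ dilate 0 (applyUpTo suc C) rare
          (Unique.cartesianProduct⁺ (unique P) (unique Q))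
  in length ys
   , subst₂ (λ a b → 2 * a * b ≤ 2 * a * length ys + b * b) (length-upTo (suc C))
       (trans (length-cartesianProductWith _,_ (part P) (part Q)) (cong₂ _*_ (size P) (size Q))) large
   , record
     { base      = dilateSum c (base P) (base Q)
     ; part      = ys
     ; base-diff = dilateSum-diff c (base-diff P) (base-diff Q)
     ; unique    = u
     ; isSum     = λ z∈ → sums c (im z∈)
     ; bounded   = λ z∈ → bound c (∈-upTo⁻ {suc C} c∈) (im z∈)
     ; size      = refl
     }
  where
  rare : ∀ p p′ → p ≢ p′ → ∑ (upTo (suc C)) (λ c → 𝟙 (dilate c p ℤₚ.≟ dilate c p′)) ≤ 1
  rare p@(x , y) p′@(x′ , y′) p≢p′ =
    ∑𝟙≤1 (λ c → dilate c p ℤₚ.≟ dilate c p′) (Unique.upTo⁺ (suc C))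
      λ {c} {c′} e e′ → ℤₚ.+-injective (dilation-determined x x′ y y′ (+ c) (+ c′) p≢p′ e e′)
  sums : ∀ c {z} → ∃[ p ] p ∈ cartesianProduct (part P) (part Q) × z ≡ dilate c p →
         InSumsetℤ k (dilateSum c (base P) (base Q)) z
  sums c ((x , y) , p∈ , refl) =
    let x∈ , y∈ = ∈-cartesianProduct⁻ (part P) (part Q) p∈
    in dilateSum-sumset c k (isSum P x∈) (isSum Q y∈)
  bound : ∀ c {z} → c < suc C → ∃[ p ] p ∈ cartesianProduct (part P) (part Q) × z ≡ dilate c p →
          ∣ z ∣ ≤ R + suc C * R′
  bound c c<C ((x , y) , p∈ , refl) = let x∈ , y∈ = ∈-cartesianProduct⁻ (part P) (part Q) p∈ in begin
    ∣ x ℤ.+ + c ℤ.* y ∣       ≤⟨ ℤₚ.∣i+j∣≤∣i∣+∣j∣ x (+ c ℤ.* y) ⟩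
    ∣ x ∣ + ∣ + c ℤ.* y ∣     ≡⟨ cong (_+_ ∣ x ∣) (ℤₚ.∣i*j∣≡∣i∣*∣j∣ (+ c) y) ⟩
    ∣ x ∣ + c * ∣ y ∣         ≤⟨ ℕₚ.+-mono-≤ (bounded P x∈) (ℕₚ.*-mono-≤ (ℕₚ.<⇒≤ c<C) (bounded Q y∈)) ⟩
    R + suc C * R′            ∎
    where open ℕₚ.≤-Reasoning

-- Once 2C exceeds the square of the number of pairs, the loss is less than one element, hence zero.
-- The radius is left uncontrolled.
full-dilateSum-part : ∀ {k d d′ w w′ R R′} → SumsetPart k d w R → SumsetPart k d′ w′ R′ →
  ∃[ R″ ] SumsetPart k (d * d′) (w * w′) R″
full-dilateSum-part {k} {d} {d′} {w} {w′} {R} {R′} P Q = build (suc p²) (s≤s (ℕₚ.m≤m+n p² _))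
  where
  p² = (w * w′) * (w * w′)
  lossless : ∀ C p y → p * p < 2 * C → 2 * C * p ≤ 2 * C * y + p * p → p ≤ y
  lossless C p y p²<2C le with p ℕₚ.≤? y
  ... | yes p≤y = p≤y
  ... | no p≰y = contradiction le (ℕₚ.<⇒≱ (begin-strict
    2 * C * y + p * p       <⟨ ℕₚ.+-monoʳ-< (2 * C * y) p²<2C ⟩
    2 * C * y + 2 * C       ≡⟨ ℕₚ.+-comm (2 * C * y) (2 * C) ⟩
    2 * C + 2 * C * y       ≡⟨ ℕₚ.*-suc (2 * C) y ⟨
    2 * C * suc y           ≤⟨ ℕₚ.*-monoʳ-≤ (2 * C) (ℕₚ.≰⇒> p≰y) ⟩
    2 * C * p               ∎))
    where open ℕₚ.≤-Reasoning
  build : ∀ C .{{_ : NonZero C}} → p² < 2 * C → ∃[ R″ ] SumsetPart k (d * d′) (w * w′) R″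
  build C p²<2C =
    let w″ , large , S = dilateSum-part P Q C
    in R + C * R′ , trim ℕₚ.≤-refl (lossless C (w * w′) w″ p²<2C large) ℕₚ.≤-refl S

-- Meant for one fixed exponent, so that its uncontrolled radius becomes the constant `M` of the
-- dense construction.
power-part : ∀ {k d w R} → SumsetPart k d w R → ∀ n → ∃[ R′ ] SumsetPart k (d ^ n) (w ^ n) R′
power-part {k} P zero = 0 , zero-part k
power-part P (suc n) = full-dilateSum-part P (proj₂ (power-part P n))

-- Taking as many dilation factors as there are pairs loses at most half of
-- the pairs, and keeps the density of the part in [-R , R] bounded below.
dense-power-part : ∀ {k d u M} → 2 ≤ u → SumsetPart k d (2 * u) M →
                   ∀ n → SumsetPart k (d ^ n) (u ^ n) (4 * M * u ^ n)
dense-power-part {k} 2≤u P zero = trim ℕₚ.≤-refl ℕₚ.≤-refl z≤n (zero-part k)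
dense-power-part {k} {d} {suc u′} {M} 2≤u P (suc n) = step (dense-power-part 2≤u P n)
  where
  u = suc u′
  p = (u ^ n) * (2 * u)
  step : SumsetPart k (d ^ n) (u ^ n) (4 * M * u ^ n) → SumsetPart k (d ^ suc n) (u ^ suc n) (4 * M * u ^ suc n)
  -- The dilation falls on `P`, whose radius `M` is fixed, and not on `Q`; so the step adds only
  -- `p * M` to the radius.
  step Q with dilateSum-part Q P p {{ℕₚ.m*n≢0 (u ^ n) (2 * u) {{ℕₚ.m^n≢0 u n}}}}
  ... | w″ , large , Q′ = trim (ℕₚ.≤-reflexive (ℕₚ.*-comm (d ^ n) d)) half radius Q′
    where
    open ℕₚ.≤-Reasoning
    instance _ = ℕₚ.m^n≢0 u n
    -- With C = p the loss is at most p/2, and p/2 is `u * u ^ n`.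
    half : u * u ^ n ≤ w″
    half = ℕₚ.*-cancelˡ-≤ (2 * p) {{ℕₚ.m*n≢0 2 p {{_}} {{ℕₚ.m*n≢0 (u ^ n) (2 * u)}}}} (ℕₚ.+-cancelʳ-≤ (p * p) _ _ (begin
      2 * p * (u * u ^ n) + p * p  ≡⟨ double u (u ^ n) ⟩
      2 * p * p                    ≤⟨ large ⟩
      2 * p * w″ + p * p           ∎))
      where
      double : ∀ u v → 2 * (v * (2 * u)) * (u * v) + v * (2 * u) * (v * (2 * u)) ≡ 2 * (v * (2 * u)) * (v * (2 * u))
      double = ℕRing.solve-∀
    -- The step adds 2M u^(n + 1), and the old radius 4M u^n is no larger than that because 2 ≤ u.
    -- This fixes the constant 4.
    radius : 4 * M * u ^ n + p * M ≤ 4 * M * (u * u ^ n)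
    radius = begin
      4 * M * u ^ n + p * M           ≡⟨ regroup M (u ^ n) u ⟩
      2 * M * u ^ n * 2 + 2 * M * u ^ n * u ≤⟨ ℕₚ.+-monoˡ-≤ _ (ℕₚ.*-monoʳ-≤ (2 * M * u ^ n) 2≤u) ⟩
      2 * M * u ^ n * u + 2 * M * u ^ n * u ≡⟨ regroup′ M (u ^ n) u ⟩
      4 * M * (u * u ^ n)             ∎
      where
      regroup : ∀ M v u → 4 * M * v + v * (2 * u) * M ≡ 2 * M * v * 2 + 2 * M * v * u
      regroup = ℕRing.solve-∀
      regroup′ : ∀ M v u → 2 * M * v * u + 2 * M * v * u ≡ 4 * M * (u * v)
      regroup′ = ℕRing.solve-∀

-- Covering an interval by translates

Covers : ℕ → ℕ → List ℤ → Set
Covers k Q A = ∃[ a ] ∀ (i : ℕ) → 1 ≤ i → i ≤ Q → InSumsetℤ k A (a ℤ.+ + i)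

-- Cover k Q d expresses g_k(Q) ≤ d.
Cover : (k Q d : ℕ) → Set
Cover k Q d = ∃[ A ] Covers k Q A × DiffBound A d

interval : ℕ → List ℤ
interval Q = map (λ i → + suc i) (upTo Q)

∈-interval : ∀ {Q i} → 1 ≤ i → i ≤ Q → + i ∈ interval Q
∈-interval {i = suc i} _ i<Q = ∈-map⁺ (λ i → + suc i) (∈-upTo⁺ i<Q)

∈-interval⁻ : ∀ {Q y} → y ∈ interval Q → ∣ y ∣ ≤ Q
∈-interval⁻ y∈ with ∈-map⁻ (λ i → + suc i) y∈
... | i , i∈ , refl = ∈-upTo⁻ i∈

length-interval : ∀ Q → length (interval Q) ≡ Q
length-interval Q = trans (length-map _ (upTo Q)) (length-upTo Q)

-- Zero is kept apart because `large-term` takes the head and the tail of its list separately.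
nonzeroBall : ℕ → List ℤ
nonzeroBall n = interval n ++ map -[1+_] (upTo n)

ball : ℕ → List ℤ
ball n = + 0 ∷ nonzeroBall n

∈-ball : ∀ {n} t → ∣ t ∣ ≤ n → t ∈ ball n
∈-ball (+ zero)  _   = here refl
∈-ball (+ suc i) i<n = there (∈-++⁺ˡ (∈-interval (s≤s z≤n) i<n))
∈-ball {n} -[1+ i ] i<n = there (∈-++⁺ʳ (interval n) (∈-map⁺ -[1+_] (∈-upTo⁺ i<n)))

length-ball : ∀ n → length (ball n) ≡ suc (n + n)
length-ball n = cong suc (trans (length-++ (interval n))
  (cong₂ _+_ (length-interval n) (trans (length-map -[1+_] (upTo n)) (length-upTo n))))

module _ {k d w R} (P : SumsetPart k d w R) .{{_ : NonZero w}} where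

  _∈P?_ : (y t : ℤ) → Dec (y ℤ.- t ∈ part P)
  y ∈P? t = DecMembership._∈?_ ℤₚ._≟_ (y ℤ.- t) (part P)

  -- Double counting: each y in `U` lies in the translate of the part by t for at least `w` shifts t
  -- in `ball (Q + R)`, namely the y - x. Hence some shift hits a proportion of at least 1/(l + 1)
  -- of `U`.
  translate-step : ∀ {Q l} → suc ((Q + R) + (Q + R)) ≤ suc l * w →
    (U : List ℤ) → (∀ {y} → y ∈ U → ∣ y ∣ ≤ Q) →
    ∃[ t ] suc l * length (filter (¬? ∘ (_∈P? t)) U) ≤ l * length U
  translate-step {Q} {l} ball≤ U U≤Q with large-term (+ 0) (nonzeroBall (Q + R)) (λ t → ∑ U (λ y → 𝟙 (y ∈P? t)))
  ... | t , _ , large = t , ℕₚ.+-cancelʳ-≤ (suc l * hits) _ _ (begin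
    suc l * rest + suc l * hits ≡⟨ ℕₚ.*-distribˡ-+ (suc l) rest hits ⟨
    suc l * (rest + hits)       ≡⟨ cong (suc l *_) (length-filter-¬ (_∈P? t) U) ⟩
    length U + l * length U     ≤⟨ ℕₚ.+-monoˡ-≤ (l * length U) U≤hits ⟩
    suc l * hits + l * length U ≡⟨ ℕₚ.+-comm (suc l * hits) _ ⟩
    l * length U + suc l * hits ∎)
    where
    open ℕₚ.≤-Reasoning
    hits = ∑ U (λ y → 𝟙 (y ∈P? t))
    rest = length (filter (¬? ∘ (_∈P? t)) U)
    cancel : ∀ y x → y ℤ.- (y ℤ.- x) ≡ x
    cancel = ℤRing.solve-∀
    many : ∀ y → y ∈ U → w ≤ ∑ (ball (Q + R)) (λ t → 𝟙 (y ∈P? t))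
    many y y∈ = subst (_≤ _) (size P)
      (length≤∑𝟙 (y ∈P?_) (ball (Q + R)) (λ x → y ℤ.- x)
        (λ {x} {x′} e → trans (sym (cancel y x)) (trans (cong (λ z → y ℤ.- z) e) (cancel y x′)))
        (unique P)
        λ {x} x∈ → ∈-ball (y ℤ.- x) (ℕₚ.≤-trans (ℤₚ.∣i-j∣≤∣i∣+∣j∣ y x) (ℕₚ.+-mono-≤ (U≤Q y∈) (bounded P x∈)))
                 , subst (_∈ part P) (sym (cancel y x)) x∈)
    U≤hits : length U ≤ suc l * hits
    U≤hits = ℕₚ.*-cancelʳ-≤ (length U) (suc l * hits) w (begin
      length U * w                ≡⟨ ∑-const U w ⟨
      ∑ U (λ _ → w)               ≤⟨ ∑-mono U many ⟩
      ∑ U (λ y → ∑ (ball (Q + R)) (λ t → 𝟙 (y ∈P? t))) ≡⟨ ∑-swap U (ball (Q + R)) (λ y t → 𝟙 (y ∈P? t)) ⟩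
      ∑ (ball (Q + R)) (λ t → ∑ U (λ y → 𝟙 (y ∈P? t))) ≤⟨ large ⟩
      length (ball (Q + R)) * hits ≡⟨ cong (_* hits) (length-ball (Q + R)) ⟩
      suc ((Q + R) + (Q + R)) * hits ≤⟨ ℕₚ.*-monoˡ-≤ hits ball≤ ⟩
      suc l * w * hits            ≡⟨ swap (suc l) w hits ⟩
      suc l * hits * w            ∎)
      where
      swap : ∀ a b c → a * b * c ≡ a * c * b
      swap = ℕRing.solve-∀

  -- Greedy choice: `U` holds the points still uncovered, and each further shift multiplies its
  -- length by at most l/(l + 1).
  translates : ∀ {Q l} → suc ((Q + R) + (Q + R)) ≤ suc l * w → ∀ j →
    ∃[ T ] length T ≡ j × ∃[ U ] (∀ {y} → y ∈ U → ∣ y ∣ ≤ Q)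
      × (∀ {y} → y ∈ interval Q → y ∈ U ⊎ ∃[ t ] t ∈ T × y ℤ.- t ∈ part P)
      × suc l ^ j * length U ≤ l ^ j * Q
  translates {Q} ball≤ zero = [] , refl , interval Q , ∈-interval⁻ , inj₁
    , ℕₚ.≤-reflexive (cong (1 *_) (length-interval Q))
  translates {Q} {l} ball≤ (suc j) with translates {Q} {l} ball≤ j
  ... | T , |T| , U , U≤Q , cov , |U| with translate-step {Q} {l} ball≤ U U≤Q
  ...   | t , shrink = t ∷ T , cong suc |T| , U′ , U≤Q ∘ proj₁ ∘ ∈-filter⁻ (¬? ∘ (_∈P? t)) , cov′ , (begin
    suc l * suc l ^ j * length U′   ≡⟨ rotate (suc l) (suc l ^ j) (length U′) ⟩
    suc l ^ j * (suc l * length U′) ≤⟨ ℕₚ.*-monoʳ-≤ (suc l ^ j) shrink ⟩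
    suc l ^ j * (l * length U)      ≡⟨ rotate′ (suc l ^ j) l (length U) ⟩
    l * (suc l ^ j * length U)      ≤⟨ ℕₚ.*-monoʳ-≤ l |U| ⟩
    l * (l ^ j * Q)                 ≡⟨ ℕₚ.*-assoc l (l ^ j) Q ⟨
    l ^ suc j * Q                   ∎)
    where
    open ℕₚ.≤-Reasoning
    U′ = filter (¬? ∘ (_∈P? t)) U
    cov′ : ∀ {y} → y ∈ interval Q → y ∈ U′ ⊎ ∃[ t′ ] t′ ∈ t ∷ T × y ℤ.- t′ ∈ part P
    cov′ {y} y∈ with cov y∈
    ... | inj₂ (t′ , t′∈ , hit) = inj₂ (t′ , there t′∈ , hit)
    ... | inj₁ y∈U with y ∈P? t
    ...   | yes hit = inj₂ (t , here refl , hit)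
    ...   | no miss = inj₁ (∈-filter⁺ (¬? ∘ (_∈P? t)) y∈U miss)
    rotate : ∀ a b c → a * b * c ≡ b * (a * c)
    rotate = ℕRing.solve-∀
    rotate′ : ∀ a b c → a * (b * c) ≡ b * (a * c)
    rotate′ = ℕRing.solve-∀

  -- Fewer than one point is left uncovered after `j` shifts. The shifts together with 0 are added
  -- to the base: one of the k summands takes the shift, the others take 0. These j + 1 numbers have
  -- at most (j + 1)² differences.
  cover-by-translates : 1 ≤ k → ∀ {Q l} → suc ((Q + R) + (Q + R)) ≤ suc l * w →
    ∀ j → l ^ j * Q < suc l ^ j → Cover k Q (d * (suc j * suc j))
  cover-by-translates 1≤k {Q} {l} ball≤ j few with translates {Q} {l} ball≤ j
  ... | T , refl , y ∷ U , _ , _ , |U| = contradiction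
          (ℕₚ.≤-trans (ℕₚ.m≤m*n (suc l ^ j) (suc (length U))) |U|) (ℕₚ.<⇒≱ few)
  ... | T , refl , [] , _ , cov , _ =
    dilateSum 1 (base P) (+ 0 ∷ T)
    , (+ 0 , covers)
    , dilateSum-diff 1 (base-diff P)
        ( cartesianProductWith ℤ._-_ (+ 0 ∷ T) (+ 0 ∷ T)
        , ∈-cartesianProductWith⁺ ℤ._-_
        , ℕₚ.≤-reflexive (length-cartesianProductWith ℤ._-_ (+ 0 ∷ T) (+ 0 ∷ T)))
    where
    regroup : ∀ y t → (y ℤ.- t) ℤ.+ + 1 ℤ.* t ≡ + 0 ℤ.+ y
    regroup = ℤRing.solve-∀
    covers : ∀ i → 1 ≤ i → i ≤ Q → InSumsetℤ k (dilateSum 1 (base P) (+ 0 ∷ T)) (+ 0 ℤ.+ + i)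
    covers i 1≤i i≤Q with cov (∈-interval 1≤i i≤Q)
    ... | inj₂ (t , t∈ , hit) = subst (InSumsetℤ k _) (regroup (+ i) t)
            (dilateSum-sumset 1 k (isSum P hit) (member-sumset k 1≤k (here refl) (there t∈)))

cover-mono : ∀ {k Q Q′ d} → Q′ ≤ Q → Cover k Q d → Cover k Q′ d
cover-mono Q′≤Q (A , (a , cov) , diff) =
  A , (a , λ i 1≤i i≤Q′ → cov i 1≤i (ℕₚ.≤-trans i≤Q′ Q′≤Q)) , diff

-- Write i - 1 = r + qQ. The first cover supplies the lower digit r, and the second, dilated by Q,
-- the upper digit q.
cover-* : ∀ {k Q Q′ d d′} .{{_ : NonZero Q}} → Cover k Q d → Cover k Q′ d′ → Cover k (Q * Q′) (d * d′)
cover-* {k} {Q} {Q′} (A , (a , cov) , diff) (A′ , (a′ , cov′) , diff′) =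
  -- The last `+ Q` arises because covers are indexed from 1, and index 1 of the upper digit has
  -- weight Q.
  dilateSum Q A A′ , (a ℤ.+ + Q ℤ.* a′ ℤ.+ + Q , covers) , dilateSum-diff Q diff diff′
  where
  digits : ∀ a a′ Q r q →
    (a ℤ.+ (+ 1 ℤ.+ r)) ℤ.+ Q ℤ.* (a′ ℤ.+ (+ 1 ℤ.+ q)) ≡ (a ℤ.+ Q ℤ.* a′ ℤ.+ Q) ℤ.+ (+ 1 ℤ.+ (r ℤ.+ q ℤ.* Q))
  digits = ℤRing.solve-∀
  covers : ∀ i → 1 ≤ i → i ≤ Q * Q′ → InSumsetℤ k (dilateSum Q A A′) (a ℤ.+ + Q ℤ.* a′ ℤ.+ + Q ℤ.+ + i)
  covers (suc i) _ i<QQ′ = subst (InSumsetℤ k _) value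
    (dilateSum-sumset Q k (cov (suc r) (s≤s z≤n) (ℕ.m%n<n i Q))
      (cov′ (suc q) (s≤s z≤n) (ℕₚ.*-cancelˡ-< Q q Q′ (ℕₚ.≤-<-trans (ℕₚ.≤-trans (ℕₚ.≤-reflexive (ℕₚ.*-comm Q q)) (ℕ.m/n*n≤m i Q)) i<QQ′))))
    where
    r = i ℕ.% Q
    q = i ℕ./ Q
    value : (a ℤ.+ + suc r) ℤ.+ + Q ℤ.* (a′ ℤ.+ + suc q) ≡ a ℤ.+ + Q ℤ.* a′ ℤ.+ + Q ℤ.+ + suc i
    value = trans (digits a a′ (+ Q) (+ r) (+ q)) (cong (λ z → a ℤ.+ + Q ℤ.* a′ ℤ.+ + Q ℤ.+ (+ 1 ℤ.+ z))
      (trans (cong (λ z → + r ℤ.+ z) (sym (ℤₚ.pos-* q Q))) (cong +_ (sym (ℕ.m≡m%n+[m/n]*n i Q)))))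

cover-^ : ∀ {k Q d} .{{_ : NonZero Q}} → Cover k Q d → ∀ n → Cover k (Q ^ n) (d ^ n)
-- The interval of length 1 that starts after -1 is the point 0.
cover-^ {k} c zero = + 0 ∷ [] , (-[1+ 0 ] , only) , zero-diff
  where
  only : ∀ i → 1 ≤ i → i ≤ 1 → InSumsetℤ k (+ 0 ∷ []) (-[1+ 0 ] ℤ.+ + i)
  only 1 _ _ = zero-sumset k (here refl)
  only (suc (suc _)) _ (s≤s ())
cover-^ c (suc n) = cover-* c (cover-^ c n)

-- Exponential growth

^-distribʳ-* : ∀ m n o → (m * n) ^ o ≡ m ^ o * n ^ o
^-distribʳ-* m n zero    = refl
^-distribʳ-* m n (suc o) rewrite ^-distribʳ-* m n o = interchange m n (m ^ o) (n ^ o)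
  where
  interchange : ∀ a b c d → a * b * (c * d) ≡ a * c * (b * d)
  interchange = ℕRing.solve-∀

^-swap : ∀ m n o → (m ^ n) ^ o ≡ (m ^ o) ^ n
^-swap m n o = trans (ℕₚ.^-*-assoc m n o) (trans (cong (m ^_) (ℕₚ.*-comm n o)) (sym (ℕₚ.^-*-assoc m o n)))

-- The first two terms of the binomial expansion of (a + 1)^(m + 1).
bernoulli : ∀ a m → a ^ suc m + suc m * a ^ m ≤ suc a ^ suc m
bernoulli a zero = ℕₚ.≤-reflexive (expand a)
  where
  expand : ∀ a → a * 1 + 1 ≡ suc a * 1
  expand = ℕRing.solve-∀
bernoulli a (suc m) = begin
  a * (a * v) + suc (suc m) * (a * v)             ≤⟨ ℕₚ.m≤m+n _ (suc m * v) ⟩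
  a * (a * v) + suc (suc m) * (a * v) + suc m * v ≡⟨ expand a v m ⟩
  suc a * (a * v + suc m * v)                     ≤⟨ ℕₚ.*-monoʳ-≤ (suc a) (bernoulli a m) ⟩
  suc a * suc a ^ suc m                           ∎
  where
  open ℕₚ.≤-Reasoning
  v = a ^ m
  expand : ∀ a v m → a * (a * v) + suc (suc m) * (a * v) + suc m * v ≡ suc a * (a * v + suc m * v)
  expand = ℕRing.solve-∀

doubling : ∀ a → 2 * a ^ suc a ≤ suc a ^ suc a
doubling a = begin
  2 * (a * a ^ a)             ≤⟨ ℕₚ.m≤m+n _ (a ^ a) ⟩
  2 * (a * a ^ a) + a ^ a     ≡⟨ expand a (a ^ a) ⟩
  a * a ^ a + suc a * a ^ a   ≤⟨ bernoulli a a ⟩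
  suc a ^ suc a               ∎
  where
  open ℕₚ.≤-Reasoning
  expand : ∀ a v → 2 * (a * v) + v ≡ a * v + suc a * v
  expand = ℕRing.solve-∀

-- As b is at least a + 1, every block of `suc a` factors gains a factor 2 by `doubling`.
exponential-gap : ∀ {a b} → a < b → ∀ i → 2 ^ i * a ^ (suc a * i) ≤ b ^ (suc a * i)
exponential-gap {a} {b} a<b i = begin
  2 ^ i * a ^ (suc a * i)     ≡⟨ cong (2 ^ i *_) (ℕₚ.^-*-assoc a (suc a) i) ⟨
  2 ^ i * (a ^ suc a) ^ i     ≡⟨ ^-distribʳ-* 2 (a ^ suc a) i ⟨
  (2 * a ^ suc a) ^ i         ≤⟨ ℕₚ.^-monoˡ-≤ i (ℕₚ.≤-trans (doubling a) (ℕₚ.^-monoˡ-≤ (suc a) a<b)) ⟩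
  (b ^ suc a) ^ i             ≡⟨ ℕₚ.^-*-assoc b (suc a) i ⟩
  b ^ (suc a * i)             ∎
  where open ℕₚ.≤-Reasoning

*-scale-< : ∀ {p e z w} → p < e → e * z ≤ w → 0 < w → p * z < w
*-scale-< {p} {z = zero} {w} p<e ez≤w 0<w = subst (_< w) (sym (ℕₚ.*-zeroʳ p)) 0<w
*-scale-< {z = suc z} p<e ez≤w 0<w = ℕₚ.<-≤-trans (ℕₚ.*-monoˡ-< (suc z) p<e) ez≤w

exponential-gap-< : ∀ {a b c} → a < b → ∀ i → c < 2 ^ i → c * a ^ (suc a * i) < b ^ (suc a * i)
exponential-gap-< {a} {b} a<b i c<2^i = *-scale-< c<2^i (exponential-gap a<b i)
  (ℕₚ.m^n>0 b {{ℕ.>-nonZero (ℕₚ.≤-<-trans z≤n a<b)}} (suc a * i))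

n<2^n : ∀ n → n < 2 ^ n
n<2^n zero    = s≤s z≤n
n<2^n (suc n) = ℕₚ.+-mono-≤ (ℕₚ.m^n>0 2 n) (ℕₚ.≤-trans (n<2^n n) (ℕₚ.m≤m+n (2 ^ n) 0))

-- Put l = 2m with m = 1 + α + 2γ. Then 2^l is at least (m + 1)², while α + 2γm is at most m².
linear<exponential : ∀ α γ → ∃[ l ] 1 ≤ l × α + γ * l < 2 ^ l
linear<exponential α γ = m + m , s≤s z≤n , (begin-strict
  α + γ * (m + m)             ≤⟨ ℕₚ.+-monoˡ-≤ (γ * (m + m)) (ℕₚ.≤-trans (ℕₚ.m≤n+m α 1) (ℕₚ.m≤m+n (1 + α) (γ + γ))) ⟩
  m + γ * (m + m)             ≤⟨ ℕₚ.m≤n+m _ (α * m) ⟩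
  α * m + (m + γ * (m + m))   ≡⟨ square α γ m ⟩
  m * m                       <⟨ ℕₚ.*-mono-< (ℕₚ.n<1+n m) (ℕₚ.n<1+n m) ⟩
  suc m * suc m               ≤⟨ ℕₚ.*-mono-≤ (n<2^n m) (n<2^n m) ⟩
  2 ^ m * 2 ^ m               ≡⟨ ℕₚ.^-distribˡ-+-* 2 m m ⟨
  2 ^ (m + m)                 ∎)
  where
  open ℕₚ.≤-Reasoning
  m = 1 + α + (γ + γ)
  square : ∀ α γ m → α * m + (m + γ * (m + m)) ≡ (1 + α + (γ + γ)) * m
  square = ℕRing.solve-∀

-- Raise α + γtl < 2^l to the power t and put i = lt.
polynomial<exponential : ∀ α γ t → 1 ≤ t → ∃[ i ] 1 ≤ i × (α + γ * i) ^ t < 2 ^ i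
polynomial<exponential α γ t@(suc _) _ with linear<exponential α (γ * t)
... | l , 1≤l , lt = l * t , ℕₚ.≤-trans 1≤l (ℕₚ.m≤m*n l t)
  , subst₂ _<_ (cong (λ z → (α + z) ^ t) (regroup γ t l)) (ℕₚ.^-*-assoc 2 l t) (ℕₚ.^-monoˡ-< t lt)
  where
  regroup : ∀ γ t l → γ * t * l ≡ γ * (l * t)
  regroup = ℕRing.solve-∀

logarithm : ∀ b → 2 ≤ b → ∀ Q → 1 ≤ Q → ∃[ n ] b ^ n ≤ Q × Q < b ^ suc n
logarithm b 2≤b (suc zero) _ = 0 , ℕₚ.≤-refl , subst (1 <_) (sym (ℕₚ.*-identityʳ b)) 2≤b
logarithm b 2≤b (suc Q@(suc _)) _ with logarithm b 2≤b Q (s≤s z≤n)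
... | n , lower , upper with suc Q ℕₚ.<? b ^ suc n
...   | yes lt = n , ℕₚ.m≤n⇒m≤1+n lower , lt
...   | no ge = suc n , ℕₚ.≮⇒≥ ge , ℕₚ.≤-<-trans upper (ℕₚ.^-monoʳ-< b 2≤b (ℕₚ.n<1+n (suc n)))

halve : ∀ x → 4 ≤ x → ∃[ u ] 2 ≤ u × 2 * u ≤ x × x ≤ 4 * u
halve x 4≤x = u , 2≤u , lower , (begin
  x               ≡⟨ ℕ.m≡m%n+[m/n]*n x 2 ⟩
  x ℕ.% 2 + u * 2 ≤⟨ ℕₚ.+-monoˡ-≤ (u * 2) (ℕₚ.≤-trans (ℕₚ.<⇒≤ (ℕ.m%n<n x 2)) (ℕₚ.*-monoˡ-≤ 2 (ℕₚ.≤-trans (s≤s z≤n) 2≤u))) ⟩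
  u * 2 + u * 2   ≡⟨ twice u ⟩
  4 * u           ∎)
  where
  open ℕₚ.≤-Reasoning
  u = x ℕ./ 2
  2≤u : 2 ≤ u
  2≤u = ℕ./-monoˡ-≤ 2 4≤x
  lower : 2 * u ≤ x
  lower = ℕₚ.≤-trans (ℕₚ.≤-reflexive (ℕₚ.*-comm 2 u)) (ℕ.m/n*n≤m x 2)
  twice : ∀ u → u * 2 + u * 2 ≡ 4 * u
  twice = ℕRing.solve-∀

-- From large sumsets to covers of intervals

-- Passing to an even size 2u by `halve` costs up to a factor 4, hence 4^r in the comparison. Taking
-- m-th powers first widens the ratio of q^r to d^s beyond 4^r.
amplify : ∀ {k d q R} r s → 2 ≤ q → SumsetPart k d q R → d ^ s < q ^ r →
          ∃[ d′ ] ∃[ u ] ∃[ M ] 2 ≤ u × SumsetPart k d′ (2 * u) M × d′ ^ s < u ^ r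
amplify {k} {d} {q} r s 2≤q P d^s<q^r =
  let M , Pᵐ = power-part P m
      u , 2≤u , 2u≤q^m , q^m≤4u = halve (q ^ m) 4≤q^m
  in d ^ m , u , M , 2≤u , trim ℕₚ.≤-refl 2u≤q^m ℕₚ.≤-refl Pᵐ , gap u q^m≤4u
  where
  -- The exponent `suc i` = 2r + 2 lifts 2^(2r + 2) above 4^r, and it makes m at least 2, so that
  -- q^m is at least 4 as `halve` requires.
  i = suc (2 * r)
  m = suc (d ^ s) * suc i
  instance _ = ℕ.>-nonZero (ℕₚ.≤-trans (s≤s z≤n) 2≤q)
  open ℕₚ.≤-Reasoning
  4≤q^m : 4 ≤ q ^ m
  4≤q^m = begin
    2 ^ 2     ≤⟨ ℕₚ.^-monoˡ-≤ 2 2≤q ⟩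
    q ^ 2     ≤⟨ ℕₚ.^-monoʳ-≤ q (ℕₚ.≤-trans (s≤s (s≤s z≤n)) (ℕₚ.m≤m+n (suc i) (d ^ s * suc i))) ⟩
    q ^ m     ∎
  gap : ∀ u → q ^ m ≤ 4 * u → (d ^ m) ^ s < u ^ r
  gap u q^m≤4u = ℕₚ.*-cancelˡ-< (4 ^ r) _ _ (begin-strict
    4 ^ r * (d ^ m) ^ s   ≡⟨ cong (4 ^ r *_) (^-swap d m s) ⟩
    4 ^ r * (d ^ s) ^ m   <⟨ exponential-gap-< d^s<q^r (suc i) 4^r< ⟩
    (q ^ r) ^ m           ≡⟨ ^-swap q r m ⟩
    (q ^ m) ^ r           ≤⟨ ℕₚ.^-monoˡ-≤ r q^m≤4u ⟩
    (4 * u) ^ r           ≡⟨ ^-distribʳ-* 4 u r ⟩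
    4 ^ r * u ^ r         ∎)
    where
    4^r< : 4 ^ r < 2 ^ suc i
    4^r< = subst (_< 2 ^ suc i) (sym (ℕₚ.^-*-assoc 2 2 r)) (ℕₚ.^-monoʳ-< 2 (s≤s (s≤s z≤n)) (ℕₚ.m≤n⇒m≤1+n (ℕₚ.n<1+n (2 * r))))

-- Every l + 1 shifts at least halve what is uncovered, so (l + 1)e of them exhaust an interval of
-- length below 2^e.
few-uncovered : ∀ l {Q e} → Q < 2 ^ e → l ^ (suc l * e) * Q < suc l ^ (suc l * e)
few-uncovered l {Q} {e} Q<2^e = subst (_< suc l ^ (suc l * e)) (ℕₚ.*-comm Q (l ^ (suc l * e)))
  (exponential-gap-< {l} {suc l} {Q} (ℕₚ.n<1+n l) e Q<2^e)

-- The density of the parts does not depend on n, so O(n) translates suffice.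
cover-from-dense : ∀ {k d u M} → 1 ≤ k → 2 ≤ u → SumsetPart k d (2 * u) M →
  ∃[ α ] ∃[ γ ] ∀ n → Cover k (u ^ n) (d ^ n * ((α + γ * n) * (α + γ * n)))
cover-from-dense {k} {d} {u} {M} 1≤k 2≤u P = build (8 * M + 2) (λ v → collect M v)
  where
  instance _ = ℕ.>-nonZero (ℕₚ.≤-trans (s≤s z≤n) 2≤u)
  open ℕₚ.≤-Reasoning
  -- For v = u^n ≥ 1 the ball of radius v + 4Mv has at most (8M + 3)v elements, whence l + 1 = 8M +
  -- 3.
  collect : ∀ M v → v + ((v + 4 * M * v) + (v + 4 * M * v)) ≡ suc (8 * M + 2) * v
  collect = ℕRing.solve-∀
  count : ∀ L u n → suc (L * suc (u * n)) ≡ suc L + L * u * n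
  count = ℕRing.solve-∀
  u^n< : ∀ n → u ^ n < 2 ^ suc (u * n)
  u^n< n = begin-strict
    u ^ n           ≤⟨ ℕₚ.^-monoˡ-≤ n (ℕₚ.<⇒≤ (n<2^n u)) ⟩
    (2 ^ u) ^ n     ≡⟨ ℕₚ.^-*-assoc 2 u n ⟩
    2 ^ (u * n)     <⟨ ℕₚ.^-monoʳ-< 2 (s≤s (s≤s z≤n)) (ℕₚ.n<1+n (u * n)) ⟩
    2 ^ suc (u * n) ∎
  build : ∀ l → (∀ v → v + ((v + 4 * M * v) + (v + 4 * M * v)) ≡ suc l * v) →
    ∃[ α ] ∃[ γ ] ∀ n → Cover k (u ^ n) (d ^ n * ((α + γ * n) * (α + γ * n)))
  -- Since u^n < 2^(un + 1), j = (l + 1)(un + 1) shifts are enough; α and γ are read off from j + 1.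
  build l density = suc (suc l) , suc l * u , λ n →
    subst (λ z → Cover k (u ^ n) (d ^ n * (z * z))) (count (suc l) u n)
      (cover-by-translates (dense-power-part 2≤u P n) {{ℕₚ.m^n≢0 u n}} 1≤k {l = l} (ball≤ n)
        (suc l * suc (u * n)) (few-uncovered l {e = suc (u * n)} (u^n< n)))
    where
    ball≤ : ∀ n → suc ((u ^ n + 4 * M * u ^ n) + (u ^ n + 4 * M * u ^ n)) ≤ suc l * u ^ n
    ball≤ n = begin
      1 + ((u ^ n + 4 * M * u ^ n) + (u ^ n + 4 * M * u ^ n))     ≤⟨ ℕₚ.+-monoˡ-≤ _ (ℕₚ.m^n>0 u n) ⟩
      u ^ n + ((u ^ n + 4 * M * u ^ n) + (u ^ n + 4 * M * u ^ n)) ≡⟨ density (u ^ n) ⟩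
      suc l * u ^ n ∎

-- The polynomial factor enters with its s-th power, of degree 2s in n, and the growth of (u^r)^n
-- over (d^s)^n outruns it.
sparse-cover : ∀ {k d u} r s → 1 ≤ s → 2 ≤ u → d ^ s < u ^ r → ∀ α γ →
  (∀ n → Cover k (u ^ n) (d ^ n * ((α + γ * n) * (α + γ * n)))) →
  ∃[ Q ] 2 ≤ Q × ∃[ D ] Cover k Q D × D ^ s < Q ^ r
sparse-cover {k} {d} {u} r s 1≤s 2≤u gap α γ cover =
  -- The exponent `n` is a multiple of `suc (d ^ s)` to fit `exponential-gap-<`, so in terms of `i`
  -- the slope γ is multiplied by d^s + 1.
  let i , 1≤i , poly = polynomial<exponential α (γ * suc (d ^ s)) (2 * s) (ℕₚ.≤-trans 1≤s (ℕₚ.m≤m+n s (s + 0)))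
      n = suc (d ^ s) * i
  in u ^ n , 2≤u^n (ℕₚ.≤-trans 1≤i (ℕₚ.m≤m+n i (d ^ s * i))) , _ , cover n
   , small n (exponential-gap-< gap i
       (subst (λ z → (α + z) ^ (2 * s) < 2 ^ i) (ℕₚ.*-assoc γ (suc (d ^ s)) i) poly))
  where
  open ℕₚ.≤-Reasoning
  2≤u^n : ∀ {n} → 1 ≤ n → 2 ≤ u ^ n
  2≤u^n {n} 1≤n = ℕₚ.≤-trans 2≤u (subst (_≤ u ^ n) (ℕₚ.^-identityʳ u)
    (ℕₚ.^-monoʳ-≤ u {{ℕ.>-nonZero (ℕₚ.≤-trans (s≤s z≤n) 2≤u)}} 1≤n))
  square : ∀ x t → (x * x) ^ t ≡ x ^ (2 * t)
  square x t = trans (cong (λ z → (x * z) ^ t) (sym (ℕₚ.*-identityʳ x))) (ℕₚ.^-*-assoc x 2 t)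
  small : ∀ n → (α + γ * n) ^ (2 * s) * (d ^ s) ^ n < (u ^ r) ^ n →
          (d ^ n * ((α + γ * n) * (α + γ * n))) ^ s < (u ^ n) ^ r
  small n lt = begin-strict
    (d ^ n * (j * j)) ^ s         ≡⟨ ^-distribʳ-* (d ^ n) (j * j) s ⟩
    (d ^ n) ^ s * (j * j) ^ s     ≡⟨ cong₂ _*_ (^-swap d n s) (square j s) ⟩
    (d ^ s) ^ n * j ^ (2 * s)     ≡⟨ ℕₚ.*-comm ((d ^ s) ^ n) (j ^ (2 * s)) ⟩
    j ^ (2 * s) * (d ^ s) ^ n     <⟨ lt ⟩
    (u ^ r) ^ n                   ≡⟨ ^-swap u r n ⟩
    (u ^ n) ^ r                   ∎
    where j = α + γ * n

part⇒cover : ∀ {k d q R} r s → 1 ≤ k → 1 ≤ s → 2 ≤ q → SumsetPart k d q R → d ^ s < q ^ r →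
             ∃[ Q ] 2 ≤ Q × ∃[ D ] Cover k Q D × D ^ s < Q ^ r
part⇒cover r s 1≤k 1≤s 2≤q P gap =
  let d , u , M , 2≤u , P′ , gap′ = amplify r s 2≤q P gap
      α , γ , cover = cover-from-dense 1≤k 2≤u P′
  in sparse-cover r s 1≤s 2≤u gap′ α γ cover

-- The extremal functions

hasSize : DecidableEquality X → {P : X → Set} (xs : List X) → (∀ x → x ∈ xs ⇔ P x) →
          ∃[ m ] HasSize P m × ((D : List X) → (∀ {x} → P x → x ∈ D) → m ≤ length D)
hasSize _≟_ xs xs⇔P = length (deduplicate _≟_ xs)
  , (deduplicate _≟_ xs , DecUnique.deduplicate-! _≟_ xs
    , (λ x → mk⇔ (to (xs⇔P x) ∘ ∈-deduplicate⁻ _≟_ xs) (∈-deduplicate⁺ _≟_ ∘ from (xs⇔P x))) , refl)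
  , λ D P⊆D → Unique-⊆⇒length≤ (DecUnique.deduplicate-! _≟_ xs)
      (P⊆D ∘ to (xs⇔P _) ∘ ∈-deduplicate⁻ _≟_ xs)

differences : List ℤ → List ℤ
differences A = cartesianProductWith ℤ._-_ A A

∈-differences : ∀ A d → d ∈ differences A ⇔ InDiffℤ A d
∈-differences A d = mk⇔ (∈-cartesianProductWith⁻ ℤ._-_ A A)
  λ { (a , b , a∈ , b∈ , refl) → ∈-cartesianProductWith⁺ ℤ._-_ a∈ b∈ }

diffSize : ∀ {A d} → DiffBound A d → ∃[ m ] HasSize (InDiffℤ A) m × m ≤ d
diffSize {A} (D , A-A , |D|) =
  let m , size , least = hasSize ℤₚ._≟_ (differences A) (∈-differences A)
  in m , size , ℕₚ.≤-trans (least D λ { (a , b , a∈ , b∈ , refl) → A-A a∈ b∈ }) |D|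

diffBound : ∀ {A m} → HasSize (InDiffℤ A) m → DiffBound A m
diffBound (D , _ , D⇔ , refl) = D , (λ a∈ b∈ → from (D⇔ _) (_ , _ , a∈ , b∈ , refl)) , ℕₚ.≤-refl

IsG⇒cover : ∀ {k q m} → IsG k q m → Cover k q m
IsG⇒cover ((A , cov , size) , _) = A , cov , diffBound size

cover⇒G≤ : ∀ {k q m d} → IsG k q m → Cover k q d → m ≤ d
cover⇒G≤ (_ , least) (A , cov , diff) =
  let m′ , size , m′≤d = diffSize diff in ℕₚ.≤-trans (least m′ (A , cov , size)) m′≤d

sums : ℕ → List ℤ → List ℤ
sums zero    A = + 0 ∷ []
sums (suc k) A = cartesianProductWith ℤ._+_ A (sums k A)

∈-sums⁻ : ∀ k A {x} → x ∈ sums k A → InSumsetℤ k A x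
∈-sums⁻ zero    A (here refl) = [] , refl , [] , refl
∈-sums⁻ (suc k) A x∈ with ∈-cartesianProductWith⁻ ℤ._+_ A (sums k A) x∈
... | a , y , a∈ , y∈ , refl with ∈-sums⁻ k A y∈
...   | v , refl , v∈ , refl = a ∷ v , refl , a∈ ∷ v∈ , refl

∈-sums⁺ : ∀ k A {x} → InSumsetℤ k A x → x ∈ sums k A
∈-sums⁺ zero    A ([] , refl , [] , refl) = here refl
∈-sums⁺ (suc k) A (a ∷ v , refl , a∈ ∷ v∈ , refl) =
  ∈-cartesianProductWith⁺ ℤ._+_ a∈ (∈-sums⁺ k A (v , refl , v∈ , refl))

IsH⇒part : ∀ {k q m} → IsH k q m → ∃[ R ] SumsetPart k m q R
-- Any radius will do; the sum of the absolute values bounds each of them. `trim` cuts `S` to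
-- exactly q elements.
IsH⇒part ((A , (n , (S , u , S⇔ , refl) , q≤n) , size) , _) = ∑ S ∣_∣ , trim ℕₚ.≤-refl q≤n ℕₚ.≤-refl (record
  { base      = A
  ; part      = S
  ; base-diff = diffBound size
  ; unique    = u
  ; isSum     = to (S⇔ _)
  ; bounded   = term≤∑ S ∣_∣
  ; size      = refl
  })

cover⇒H≤ : ∀ {k q m d} → IsH k q m → Cover k q d → m ≤ d
cover⇒H≤ {k} {q} (_ , least) (A , (a , cov) , diff) =
  let m′ , size , m′≤d = diffSize diff
      n , S , _ = hasSize ℤₚ._≟_ (sums k A) (λ x → mk⇔ (∈-sums⁻ k A) (∈-sums⁺ k A))
  in ℕₚ.≤-trans (least m′ (A , (n , S , large S) , size)) m′≤d
  where
  shift : ℕ → ℤ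
  shift i = a ℤ.+ + suc i
  shift-injective : ∀ {i j} → shift i ≡ shift j → i ≡ j
  shift-injective {i} {j} e = ℕₚ.suc-injective (ℤₚ.+-injective
    (trans (sym (cancel a (+ suc i))) (trans (cong (ℤ._- a) e) (cancel a (+ suc j)))))
    where
    cancel : ∀ a x → (a ℤ.+ x) ℤ.- a ≡ x
    cancel = ℤRing.solve-∀
  large : ∀ {n} → HasSize (InSumsetℤ k A) n → q ≤ n
  large (S , _ , S⇔ , refl) = subst (_≤ length S) (trans (length-map shift (upTo q)) (length-upTo q))
    (Unique-⊆⇒length≤ (Unique.map⁺ shift-injective (Unique.upTo⁺ q)) sub)
    where
    sub : ∀ {x} → x ∈ map shift (upTo q) → x ∈ S
    sub x∈ with ∈-map⁻ shift x∈
    ... | i , i∈ , refl = from (S⇔ _) (cov (suc i) (s≤s z≤n) (∈-upTo⁻ i∈))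

-- Residues modulo q

-- One signed multiple replaces the two natural ones of `ModEq`, so that congruences are added and
-- negated by ring identities.
record Congruent (q : ℕ) (x y : ℤ) : Set where
  constructor congruent
  field
    multiple : ℤ
    equation : x ≡ y ℤ.+ multiple ℤ.* + q

module _ {q : ℕ} where

  private
    infix 4 _≈_
    _≈_ = Congruent q

  ≈-sym : ∀ {x y} → x ≈ y → y ≈ x
  ≈-sym {y = y} (congruent z refl) = congruent (ℤ.- z) (identity y z (+ q))
    where
    identity : ∀ y z q → y ≡ (y ℤ.+ z ℤ.* q) ℤ.+ ℤ.- z ℤ.* q
    identity = ℤRing.solve-∀

  ≈-trans : ∀ {x y w} → x ≈ y → y ≈ w → x ≈ w
  ≈-trans {w = w} (congruent z refl) (congruent z′ refl) = congruent (z′ ℤ.+ z) (identity w z z′ (+ q))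
    where
    identity : ∀ w z z′ q → (w ℤ.+ z′ ℤ.* q) ℤ.+ z ℤ.* q ≡ w ℤ.+ (z′ ℤ.+ z) ℤ.* q
    identity = ℤRing.solve-∀

  ≈-+ : ∀ {x y x′ y′} → x ≈ y → x′ ≈ y′ → x ℤ.+ x′ ≈ y ℤ.+ y′
  ≈-+ {y = y} {y′ = y′} (congruent z refl) (congruent z′ refl) = congruent (z ℤ.+ z′) (identity y y′ z z′ (+ q))
    where
    identity : ∀ y y′ z z′ q → (y ℤ.+ z ℤ.* q) ℤ.+ (y′ ℤ.+ z′ ℤ.* q) ≡ (y ℤ.+ y′) ℤ.+ (z ℤ.+ z′) ℤ.* q
    identity = ℤRing.solve-∀

  ≈-neg : ∀ {x y} → x ≈ y → ℤ.- x ≈ ℤ.- y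
  ≈-neg {y = y} (congruent z refl) = congruent (ℤ.- z) (identity y z (+ q))
    where
    identity : ∀ y z q → ℤ.- (y ℤ.+ z ℤ.* q) ≡ ℤ.- y ℤ.+ ℤ.- z ℤ.* q
    identity = ℤRing.solve-∀

  ≈-reflexive : ∀ {x y} → x ≡ y → x ≈ y
  ≈-reflexive {y = y} refl = congruent (+ 0) (sym (ℤₚ.+-identityʳ y))

  pos-+* : ∀ x i → + (x + i * q) ≡ + x ℤ.+ + i ℤ.* + q
  pos-+* x i = cong (λ z → + x ℤ.+ z) (ℤₚ.pos-* i q)

  ModEq⇒≈ : ∀ {x y} → ModEq q x y → + x ≈ + y
  ModEq⇒≈ {x} {y} (i , j , e) = ≈-trans (≈-sym (congruent (+ i) (pos-+* x i)))
    (≈-trans (≈-reflexive (cong +_ e)) (congruent (+ j) (pos-+* y j)))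

  ≈⇒ModEq : ∀ {x y} → + x ≈ + y → ModEq q x y
  ≈⇒ModEq {x} {y} (congruent (+ n) e) = 0 , n , trans (ℕₚ.+-identityʳ x)
    (ℤₚ.+-injective (trans e (sym (pos-+* y n))))
  ≈⇒ModEq {x} {y} (congruent (-[1+ n ]) e) = suc n , 0 , trans (ℤₚ.+-injective (begin
    + (x + suc n * q)                               ≡⟨ pos-+* x (suc n) ⟩
    + x ℤ.+ + suc n ℤ.* + q                         ≡⟨ cong (λ z → z ℤ.+ + suc n ℤ.* + q) e ⟩
    (+ y ℤ.+ -[1+ n ] ℤ.* + q) ℤ.+ + suc n ℤ.* + q  ≡⟨ cancel (+ y) (+ suc n) (+ q) ⟩
    + y                                             ∎)) (sym (ℕₚ.+-identityʳ y))
    where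
    open ≡-Reasoning
    cancel : ∀ y n q → (y ℤ.+ ℤ.- n ℤ.* q) ℤ.+ n ℤ.* q ≡ y
    cancel = ℤRing.solve-∀

  module _ .{{_ : NonZero q}} where

    ModEq⇒%≡ : ∀ {x y} → ModEq q x y → x ℕ.% q ≡ y ℕ.% q
    ModEq⇒%≡ {x} {y} (i , j , e) =
      trans (sym (ℕ.[m+kn]%n≡m%n x i q)) (trans (cong (ℕ._% q) e) (ℕ.[m+kn]%n≡m%n y j q))

    ≈⇒≡ : ∀ {x y : Fin q} → + toℕ x ≈ + toℕ y → x ≡ y
    ≈⇒≡ {x} {y} x≈y = Finₚ.toℕ-injective (begin
      toℕ x         ≡⟨ ℕ.m<n⇒m%n≡m (Finₚ.toℕ<n x) ⟨
      toℕ x ℕ.% q   ≡⟨ ModEq⇒%≡ (≈⇒ModEq x≈y) ⟩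
      toℕ y ℕ.% q   ≡⟨ ℕ.m<n⇒m%n≡m (Finₚ.toℕ<n y) ⟩
      toℕ y         ∎)
      where open ≡-Reasoning

    residue : ℤ → Fin q
    residue x = fromℕ< (ℤ.n%ℕd<d x q)

    residue-≈ : ∀ x → + toℕ (residue x) ≈ x
    residue-≈ x = ≈-trans (≈-reflexive (cong +_ (Finₚ.toℕ-fromℕ< (ℤ.n%ℕd<d x q))))
      (≈-sym (congruent (x ℤ./ℕ q) (ℤ.a≡a%ℕn+[a/ℕn]*n x q)))

    sum-residues : ∀ v → + sumℕ (map toℕ (map residue v)) ≈ sumℤ v
    sum-residues []      = ≈-reflexive refl
    sum-residues (a ∷ v) = ≈-+ (residue-≈ a) (sum-residues v)

    residues-cover : ∀ {k A} → Covers k q A → ∀ x → InSumsetZq q k (map residue A) x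
    residues-cover {k} {A} (a , cov) x =
      -- The q consecutive integers after `a` meet every class, and a + 1 + i is the one congruent
      -- to x.
      let i = residue (+ toℕ x ℤ.- (a ℤ.+ + 1))
          v , |v| , v∈ , Σv = cov (suc (toℕ i)) (s≤s z≤n) (Finₚ.toℕ<n i)
      in map residue v , trans (length-map residue v) |v| , Allₚ.map⁺ (All.map (∈-map⁺ residue) v∈)
       , ≈⇒ModEq (≈-trans (sum-residues v) (≈-trans (≈-reflexive (trans Σv (sym (ℤₚ.+-assoc a (+ 1) (+ toℕ i)))))
           (≈-trans (≈-+ (≈-reflexive {a ℤ.+ + 1} refl) (residue-≈ (+ toℕ x ℤ.- (a ℤ.+ + 1))))
             (≈-reflexive (cancel (a ℤ.+ + 1) (+ toℕ x))))))
      where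
      cancel : ∀ b x → b ℤ.+ (x ℤ.- b) ≡ x
      cancel = ℤRing.solve-∀

    residue-difference : ∀ (d : Fin q) (a b : ℤ) →
      ModEq q (toℕ d + toℕ (residue b)) (toℕ (residue a)) ⇔ d ≡ residue (a ℤ.- b)
    residue-difference d a b = mk⇔ forward backward
      where
      cancel : ∀ d b → d ≡ (d ℤ.+ b) ℤ.- b
      cancel = ℤRing.solve-∀
      cancel′ : ∀ a b → (a ℤ.- b) ℤ.+ b ≡ a
      cancel′ = ℤRing.solve-∀
      forward : ModEq q (toℕ d + toℕ (residue b)) (toℕ (residue a)) → d ≡ residue (a ℤ.- b)
      forward e = ≈⇒≡ (≈-trans (≈-reflexive (cancel (+ toℕ d) (+ toℕ (residue b))))
        (≈-trans (≈-+ (≈-trans (ModEq⇒≈ e) (residue-≈ a)) (≈-neg (residue-≈ b)))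
          (≈-sym (residue-≈ (a ℤ.- b)))))
      backward : d ≡ residue (a ℤ.- b) → ModEq q (toℕ d + toℕ (residue b)) (toℕ (residue a))
      backward refl = ≈⇒ModEq (≈-trans (≈-+ (residue-≈ (a ℤ.- b)) (residue-≈ b))
        (≈-trans (≈-reflexive (cancel′ a b)) (≈-sym (residue-≈ a))))

    -- Reduction modulo q is a homomorphism, so a list holding the differences of `A` reduces to one
    -- holding those of its image.
    cover⇒F≤ : ∀ {k m d} → IsF k q m → Cover k q d → m ≤ d
    cover⇒F≤ (_ , least) (A , cov , D , A-A , |D|) =
      let m′ , size , m′≤ = hasSize Finₚ._≟_ (map residue (differences A)) (λ x → mk⇔ diff⁻ diff⁺)
      in ℕₚ.≤-trans (least m′ (map residue A , residues-cover cov , size))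
           (ℕₚ.≤-trans (m′≤ (map residue D) inD) (ℕₚ.≤-trans (ℕₚ.≤-reflexive (length-map residue D)) |D|))
      where
      diff⁻ : ∀ {x} → x ∈ map residue (differences A) → InDiffZq q (map residue A) x
      diff⁻ x∈ with ∈-map⁻ residue x∈
      ... | _ , d∈ , e with to (∈-differences A _) d∈
      ...   | a , b , a∈ , b∈ , refl = _ , _ , ∈-map⁺ residue a∈ , ∈-map⁺ residue b∈ , from (residue-difference _ a b) e
      diff : ∀ {x} → InDiffZq q (map residue A) x → ∃[ a ] ∃[ b ] a ∈ A × b ∈ A × x ≡ residue (a ℤ.- b)
      diff (_ , _ , a∈ , b∈ , e) with ∈-map⁻ residue a∈ | ∈-map⁻ residue b∈
      ... | a , a∈A , refl | b , b∈A , refl = a , b , a∈A , b∈A , to (residue-difference _ a b) e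
      diff⁺ : ∀ {x} → InDiffZq q (map residue A) x → x ∈ map residue (differences A)
      diff⁺ x∈ with diff x∈
      ... | a , b , a∈A , b∈A , refl = ∈-map⁺ residue (from (∈-differences A _) (a , b , a∈A , b∈A , refl))
      inD : ∀ {x} → InDiffZq q (map residue A) x → x ∈ map residue D
      inD x∈ with diff x∈
      ... | a , b , a∈A , b∈A , refl = ∈-map⁺ residue (A-A a∈A b∈A)

    -- Lifting a cover of the residues to the integers

    lift : List (Fin q) → List ℤ
    lift A = cartesianProductWith (λ a ε → + toℕ a ℤ.- + ε ℤ.* + q) A (0 ∷ 1 ∷ [])

    -- Write a - b = d - δq with d in the difference set modulo q and δ either 0 or 1. Differences
    -- of the lift are then d + (ε′ - ε - δ)q, whose coefficient takes only the four values from -2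
    -- to 1.
    lift-diff : ∀ {A m} → HasSize (InDiffZq q A) m → DiffBound (lift A) (m * 4)
    lift-diff {A} (D , _ , D⇔ , refl) =
      cartesianProductWith shift D shifts , diff , ℕₚ.≤-reflexive (length-cartesianProductWith shift D shifts)
      where
      shift : Fin q → ℤ → ℤ
      shift d j = + toℕ d ℤ.+ j ℤ.* + q
      shifts : List ℤ
      shifts = -[1+ 1 ] ∷ -[1+ 0 ] ∷ + 0 ∷ + 1 ∷ []
      shift∈ : ∀ {ε ε′ δ} → ε ∈ 0 ∷ 1 ∷ [] → ε′ ∈ 0 ∷ 1 ∷ [] → δ ∈ 0 ∷ 1 ∷ [] →
               (+ ε′ ℤ.- + ε) ℤ.- + δ ∈ shifts
      shift∈ (here refl) (here refl) (here refl) = there (there (here refl))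
      shift∈ (here refl) (here refl) (there (here refl)) = there (here refl)
      shift∈ (here refl) (there (here refl)) (here refl) = there (there (there (here refl)))
      shift∈ (here refl) (there (here refl)) (there (here refl)) = there (there (here refl))
      shift∈ (there (here refl)) (here refl) (here refl) = there (here refl)
      shift∈ (there (here refl)) (here refl) (there (here refl)) = here refl
      shift∈ (there (here refl)) (there (here refl)) (here refl) = there (there (here refl))
      shift∈ (there (here refl)) (there (here refl)) (there (here refl)) = there (here refl)
      representative : ∀ (a b : Fin q) → a ∈ A → b ∈ A → ∀ {n} δ → n < q → δ ∈ 0 ∷ 1 ∷ [] →
        n + toℕ b ≡ toℕ a + δ * q →
        ∃[ d ] ∃[ δ ] d ∈ D × δ ∈ 0 ∷ 1 ∷ [] × + toℕ a ℤ.- + toℕ b ≡ + toℕ d ℤ.- + δ ℤ.* + q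
      representative a b a∈ b∈ {n} δ n<q δ∈ e = d , δ
        , from (D⇔ d) (a , b , a∈ , b∈ , 0 , δ , trans (ℕₚ.+-identityʳ _) d+b) , δ∈
        , trans (move (+ toℕ a) (+ δ ℤ.* + q) (+ toℕ b))
            (cong (λ z → z ℤ.- + δ ℤ.* + q) (trans (cong (λ z → z ℤ.- + toℕ b)
              (trans (sym (pos-+* (toℕ a) δ)) (cong +_ (sym d+b)))) (cancel (+ toℕ d) (+ toℕ b))))
        where
        d = fromℕ< n<q
        d+b : toℕ d + toℕ b ≡ toℕ a + δ * q
        d+b = trans (cong (_+ toℕ b) (Finₚ.toℕ-fromℕ< n<q)) e
        move : ∀ a t b → a ℤ.- b ≡ ((a ℤ.+ t) ℤ.- b) ℤ.- t
        move = ℤRing.solve-∀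
        cancel : ∀ d b → (d ℤ.+ b) ℤ.- b ≡ d
        cancel = ℤRing.solve-∀
      -- δ records the wrap-around: the residue of a - b is a - b itself if b ≤ a, and a + (q - b)
      -- otherwise.
      wrap : ∀ (a b : Fin q) → a ∈ A → b ∈ A →
             ∃[ d ] ∃[ δ ] d ∈ D × δ ∈ 0 ∷ 1 ∷ [] × + toℕ a ℤ.- + toℕ b ≡ + toℕ d ℤ.- + δ ℤ.* + q
      wrap a b a∈ b∈ with toℕ b ℕₚ.≤? toℕ a
      ... | yes b≤a = representative a b a∈ b∈ 0
              (ℕₚ.≤-<-trans (ℕₚ.m∸n≤m (toℕ a) (toℕ b)) (Finₚ.toℕ<n a)) (here refl)
              (trans (ℕₚ.m∸n+n≡m b≤a) (sym (ℕₚ.+-identityʳ (toℕ a))))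
      ... | no b≰a = representative a b a∈ b∈ 1
              (ℕₚ.<-≤-trans (ℕₚ.+-monoˡ-< (q ∸ toℕ b) (ℕₚ.≰⇒> b≰a)) (ℕₚ.≤-reflexive (ℕₚ.m+[n∸m]≡n b≤q)))
              (there (here refl))
              (trans (ℕₚ.+-assoc (toℕ a) (q ∸ toℕ b) (toℕ b))
                (cong (_+_ (toℕ a)) (trans (ℕₚ.m∸n+n≡m b≤q) (sym (ℕₚ.+-identityʳ q)))))
        where b≤q = ℕₚ.<⇒≤ (Finₚ.toℕ<n b)
      regroup : ∀ a b ε ε′ d δ q → a ℤ.- b ≡ d ℤ.- δ ℤ.* q →
        (a ℤ.- ε ℤ.* q) ℤ.- (b ℤ.- ε′ ℤ.* q) ≡ d ℤ.+ ((ε′ ℤ.- ε) ℤ.- δ) ℤ.* q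
      regroup a b ε ε′ d δ q e = trans (split a b ε ε′ q)
        (trans (cong (ℤ._+ ((ε′ ℤ.- ε) ℤ.* q)) e) (join d ε ε′ δ q))
        where
        split : ∀ a b ε ε′ q → (a ℤ.- ε ℤ.* q) ℤ.- (b ℤ.- ε′ ℤ.* q) ≡ (a ℤ.- b) ℤ.+ (ε′ ℤ.- ε) ℤ.* q
        split = ℤRing.solve-∀
        join : ∀ d ε ε′ δ q → (d ℤ.- δ ℤ.* q) ℤ.+ (ε′ ℤ.- ε) ℤ.* q ≡ d ℤ.+ ((ε′ ℤ.- ε) ℤ.- δ) ℤ.* q
        join = ℤRing.solve-∀
      diff : ∀ {x y} → x ∈ lift A → y ∈ lift A → x ℤ.- y ∈ cartesianProductWith shift D shifts
      diff x∈ y∈ with ∈-cartesianProductWith⁻ _ A _ x∈ | ∈-cartesianProductWith⁻ _ A _ y∈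
      ... | a , ε , a∈ , ε∈ , refl | b , ε′ , b∈ , ε′∈ , refl with wrap a b a∈ b∈
      ...   | d , δ , d∈ , δ∈ , e =
        subst (_∈ cartesianProductWith shift D shifts) (sym (regroup (+ toℕ a) (+ toℕ b) (+ ε) (+ ε′) (+ toℕ d) (+ δ) (+ q) e))
          (∈-cartesianProductWith⁺ shift d∈ (shift∈ ε∈ ε′∈ δ∈))

    -- The first `j` summands are taken from A - q, the others from A.
    lift-sum : ∀ {A} v → All (_∈ A) v → ∀ j → j ≤ length v →
               InSumsetℤ (length v) (lift A) (+ sumℕ (map toℕ v) ℤ.- + j ℤ.* + q)
    lift-sum [] [] zero _ = [] , refl , [] , refl
    lift-sum {A} (a ∷ v) (a∈ ∷ v∈) j j≤ = extend j j≤
      where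
      regroup : ∀ a S ε j q → (a ℤ.- ε ℤ.* q) ℤ.+ (S ℤ.- j ℤ.* q) ≡ (a ℤ.+ S) ℤ.- (ε ℤ.+ j) ℤ.* q
      regroup = ℤRing.solve-∀
      cons : ∀ ε → ε ∈ 0 ∷ 1 ∷ [] → ∀ j → j ≤ length v →
             InSumsetℤ (suc (length v)) (lift A) (+ sumℕ (map toℕ (a ∷ v)) ℤ.- + (ε + j) ℤ.* + q)
      cons ε ε∈ j j≤ with lift-sum v v∈ j j≤
      ... | w , |w| , w∈ , Σw = (+ toℕ a ℤ.- + ε ℤ.* + q) ∷ w , cong suc |w|
          , ∈-cartesianProductWith⁺ _ a∈ ε∈ ∷ w∈
          , trans (cong (λ z → (+ toℕ a ℤ.- + ε ℤ.* + q) ℤ.+ z) Σw)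
              (regroup (+ toℕ a) (+ sumℕ (map toℕ v)) (+ ε) (+ j) (+ q))
      extend : ∀ j → j ≤ suc (length v) →
               InSumsetℤ (suc (length v)) (lift A) (+ sumℕ (map toℕ (a ∷ v)) ℤ.- + j ℤ.* + q)
      extend zero    _        = cons 0 (here refl) 0 z≤n
      extend (suc j) (s≤s j≤) = cons 1 (there (here refl)) j j≤

    sum-bound : (v : List (Fin q)) → sumℕ (map toℕ v) ≤ length v * q
    sum-bound []      = z≤n
    sum-bound (a ∷ v) = ℕₚ.+-mono-≤ (ℕₚ.<⇒≤ (Finₚ.toℕ<n a)) (sum-bound v)

    -- A sum σ of k residues that is congruent to i < q lies between 0 and kq. So σ = i + jq with j
    -- ≤ k, and `lift-sum` removes the surplus jq. This reaches 0, ..., q - 1, hence the starting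
    -- point -1.
    IsF⇒cover : ∀ {k m} → IsF k q m → Cover k q (m * 4)
    IsF⇒cover {k} ((A , cov , size) , _) = lift A , (-[1+ 0 ] , covers) , lift-diff size
      where
      shift : ∀ x → x ≡ -[1+ 0 ] ℤ.+ (+ 1 ℤ.+ x)
      shift = ℤRing.solve-∀
      cancel : ∀ x t → (x ℤ.+ t) ℤ.- t ≡ x
      cancel = ℤRing.solve-∀
      covers : ∀ i → 1 ≤ i → i ≤ q → InSumsetℤ k (lift A) (-[1+ 0 ] ℤ.+ + i)
      covers (suc i) _ i<q with cov (fromℕ< i<q)
      ... | v , refl , v∈ , e = subst (InSumsetℤ (length v) (lift A)) value (lift-sum v v∈ j j≤)
        where
        σ = sumℕ (map toℕ v)
        j = σ ℕ./ q
        j≤ : j ≤ length v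
        j≤ = ℕₚ.*-cancelʳ-≤ j (length v) q (ℕₚ.≤-trans (ℕ.m/n*n≤m σ q) (sum-bound v))
        σ%q : σ ℕ.% q ≡ i
        σ%q = trans (ModEq⇒%≡ e) (trans (cong (ℕ._% q) (Finₚ.toℕ-fromℕ< i<q)) (ℕ.m<n⇒m%n≡m i<q))
        σ≡ : σ ≡ i + j * q
        σ≡ = trans (ℕ.m≡m%n+[m/n]*n σ q) (cong (_+ j * q) σ%q)
        value : + σ ℤ.- + j ℤ.* + q ≡ -[1+ 0 ] ℤ.+ + suc i
        value = trans (cong (λ z → z ℤ.- + j ℤ.* + q) (trans (cong +_ σ≡) (pos-+* i j)))
          (trans (cancel (+ i) (+ j ℤ.* + q)) (shift (+ i)))

-- Limits

-- For q₀^n ≤ q < q₀^(n + 1), powers of a single cover give F(q) ≤ G(q₀)^(n + 1). For large n the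
-- strict gap at q₀ absorbs the surplus factor G(q₀). The function `F` will be each of f, g and h.
eventually-below : ∀ {k} (F G : ℕ → ℕ) → (∀ q → 2 ≤ q → Cover k q (G q)) →
  (∀ q → 2 ≤ q → ∀ {d} → Cover k q d → F q ≤ d) →
  ∀ r s → InfBelow G r s → ∃[ N ] ∀ q → N ≤ q → F q ^ s < q ^ r
eventually-below F G cover F≤ r s (q₀ , 2≤q₀ , gap) = q₀ ^ suc n₀ , below
  where
  instance _ = ℕ.>-nonZero (ℕₚ.≤-trans (s≤s z≤n) 2≤q₀)
  open ℕₚ.≤-Reasoning
  a = G q₀ ^ s
  b = q₀ ^ r
  -- By `exponential-gap-<` with i = a, the exponent `n₀` already gains more than the extra factor
  -- `a`, because a < 2^a.
  n₀ = suc a * a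
  instance _ = ℕₚ.m^n≢0 q₀ r
  gap-from : ∀ n → n₀ ≤ n → a ^ suc n < b ^ n
  gap-from n n₀≤n = begin-strict
    a * a ^ n                   ≡⟨ cong (λ m → a * a ^ m) (ℕₚ.m+[n∸m]≡n n₀≤n) ⟨
    a * a ^ (n₀ + e)            ≡⟨ cong (a *_) (ℕₚ.^-distribˡ-+-* a n₀ e) ⟩
    a * (a ^ n₀ * a ^ e)        ≡⟨ ℕₚ.*-assoc a (a ^ n₀) (a ^ e) ⟨
    a * a ^ n₀ * a ^ e          ≤⟨ ℕₚ.*-monoʳ-≤ (a * a ^ n₀) (ℕₚ.^-monoˡ-≤ e (ℕₚ.<⇒≤ gap)) ⟩
    a * a ^ n₀ * b ^ e          <⟨ ℕₚ.*-monoˡ-< (b ^ e) {{ℕₚ.m^n≢0 b e}} (exponential-gap-< gap a (n<2^n a)) ⟩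
    b ^ n₀ * b ^ e              ≡⟨ ℕₚ.^-distribˡ-+-* b n₀ e ⟨
    b ^ (n₀ + e)                ≡⟨ cong (b ^_) (ℕₚ.m+[n∸m]≡n n₀≤n) ⟩
    b ^ n                       ∎
    where e = n ∸ n₀
  below : ∀ q → q₀ ^ suc n₀ ≤ q → F q ^ s < q ^ r
  below q N≤q =
    let n , lower , upper = logarithm q₀ 2≤q₀ q (ℕₚ.≤-trans (ℕₚ.m^n>0 q₀ (suc n₀)) N≤q)
    in bound n lower upper
    where
    2≤q : 2 ≤ q
    2≤q = ℕₚ.≤-trans 2≤q₀ (ℕₚ.≤-trans (ℕₚ.m≤m*n q₀ (q₀ ^ n₀) {{ℕₚ.m^n≢0 q₀ n₀}}) N≤q)
    bound : ∀ n → q₀ ^ n ≤ q → q < q₀ ^ suc n → F q ^ s < q ^ r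
    bound n lower upper = begin-strict
      F q ^ s             ≤⟨ ℕₚ.^-monoˡ-≤ s (F≤ q 2≤q (cover-mono (ℕₚ.<⇒≤ upper) (cover-^ (cover q₀ 2≤q₀) (suc n)))) ⟩
      (G q₀ ^ suc n) ^ s  ≡⟨ ^-swap (G q₀) (suc n) s ⟩
      a ^ suc n           <⟨ gap-from n n₀≤n ⟩
      b ^ n               ≡⟨ ^-swap q₀ r n ⟩
      (q₀ ^ n) ^ r        ≤⟨ ℕₚ.^-monoˡ-≤ r lower ⟩
      q ^ r               ∎
      where
      n₀≤n : n₀ ≤ n
      n₀≤n = ℕₚ.≮⇒≥ λ n<n₀ → ℕₚ.<-irrefl refl
        (ℕₚ.<-≤-trans upper (ℕₚ.≤-trans (ℕₚ.^-monoʳ-≤ q₀ (ℕₚ.m≤n⇒m≤1+n n<n₀)) N≤q))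

-- If F(q)^s ≤ q^r, then q^r′ ≤ G(q)^s′ ≤ (F(q)K)^s′ gives q^(r′s) ≤ q^(rs′) K^(s′s). As rs′ + 1 ≤
-- r′s, this fails once q exceeds K^(s′s).
eventually-above : ∀ (F G : ℕ → ℕ) K .{{_ : NonZero K}} → (∀ q → 2 ≤ q → G q ≤ F q * K) →
  ∀ r s r′ s′ → r * s′ < r′ * s → InfAtLeast G r′ s′ → ∃[ N ] ∀ q → N ≤ q → q ^ r < F q ^ s
eventually-above F G K G≤FK r s r′ s′ r/s<r′/s′ atLeast = 2 + K ^ (s′ * s) , above
  where
  open ℕₚ.≤-Reasoning
  above : ∀ q → 2 + K ^ (s′ * s) ≤ q → q ^ r < F q ^ s
  above q N≤q = ℕₚ.≰⇒> λ Fˢ≤qʳ → ℕₚ.<-irrefl refl (begin-strict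
    (F q * K) ^ (s′ * s)              ≡⟨ ^-distribʳ-* (F q) K (s′ * s) ⟩
    F q ^ (s′ * s) * K ^ (s′ * s)     ≡⟨ cong (λ e → F q ^ e * K ^ (s′ * s)) (ℕₚ.*-comm s′ s) ⟩
    F q ^ (s * s′) * K ^ (s′ * s)     ≡⟨ cong (_* K ^ (s′ * s)) (ℕₚ.^-*-assoc (F q) s s′) ⟨
    (F q ^ s) ^ s′ * K ^ (s′ * s)     ≤⟨ ℕₚ.*-monoˡ-≤ (K ^ (s′ * s)) (ℕₚ.^-monoˡ-≤ s′ Fˢ≤qʳ) ⟩
    (q ^ r) ^ s′ * K ^ (s′ * s)       ≡⟨ cong (_* K ^ (s′ * s)) (ℕₚ.^-*-assoc q r s′) ⟩
    q ^ (r * s′) * K ^ (s′ * s)       <⟨ ℕₚ.*-monoʳ-< (q ^ (r * s′)) {{ℕₚ.m^n≢0 q (r * s′)}} K<q ⟩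
    q ^ (r * s′) * q                  ≡⟨ ℕₚ.*-comm (q ^ (r * s′)) q ⟩
    q ^ suc (r * s′)                  ≤⟨ ℕₚ.^-monoʳ-≤ q r/s<r′/s′ ⟩
    q ^ (r′ * s)                      ≡⟨ ℕₚ.^-*-assoc q r′ s ⟨
    (q ^ r′) ^ s                      ≤⟨ ℕₚ.^-monoˡ-≤ s (atLeast q 2≤q) ⟩
    (G q ^ s′) ^ s                    ≤⟨ ℕₚ.^-monoˡ-≤ s (ℕₚ.^-monoˡ-≤ s′ (G≤FK q 2≤q)) ⟩
    ((F q * K) ^ s′) ^ s              ≡⟨ ℕₚ.^-*-assoc (F q * K) s′ s ⟩
    (F q * K) ^ (s′ * s)              ∎)
    where
    2≤q : 2 ≤ q
    2≤q = ℕₚ.≤-trans (ℕₚ.m≤m+n 2 _) N≤q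
    instance _ = ℕ.>-nonZero (ℕₚ.≤-trans (s≤s z≤n) 2≤q)
    K<q : K ^ (s′ * s) < q
    K<q = ℕₚ.≤-trans (ℕₚ.n≤1+n _) N≤q

theorem3 : (k : ℕ) → 1 ≤ k → (f g h : ℕ → ℕ)
    → (∀ q → 2 ≤ q → IsF k q (f q))
    → (∀ q → 2 ≤ q → IsG k q (g q))
    → (∀ q → 2 ≤ q → IsH k q (h q))
    → LimitIsInf f g × LimitIsInf g g × LimitIsInf h g × SameInf h g
theorem3 k 1≤k f g h isF isG isH =
  ( (λ r s r′ s′ _ _ → eventually-above f g 4 g≤4f r s r′ s′)
  , (λ r s _ → eventually-below f g cover f≤ r s) )
  , ( (λ r s r′ s′ _ _ → eventually-above g g 1 (λ q _ → ℕₚ.m≤m*n (g q) 1) r s r′ s′)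
    , (λ r s _ → eventually-below g g cover g≤ r s) )
  -- The lower bound passes from g to h by `h-atLeast`, the contrapositive of `below-g`; then h is
  -- compared with itself, with K = 1.
  , ( (λ r s r′ s′ _ 1≤s′ lt → eventually-above h h 1 (λ q _ → ℕₚ.m≤m*n (h q) 1) r s r′ s′ lt ∘ h-atLeast r′ s′ 1≤s′)
    , (λ r s _ → eventually-below h g cover h≤ r s) )
  , λ r s 1≤s → mk⇔ (below-g r s 1≤s) (below-h r s)
  where
  cover : ∀ q → 2 ≤ q → Cover k q (g q)
  cover q 2≤q = IsG⇒cover (isG q 2≤q)
  f≤ : ∀ q → 2 ≤ q → ∀ {d} → Cover k q d → f q ≤ d
  f≤ q 2≤q = cover⇒F≤ {{ℕ.>-nonZero (ℕₚ.≤-trans (s≤s z≤n) 2≤q)}} (isF q 2≤q)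
  g≤ : ∀ q → 2 ≤ q → ∀ {d} → Cover k q d → g q ≤ d
  g≤ q 2≤q = cover⇒G≤ (isG q 2≤q)
  h≤ : ∀ q → 2 ≤ q → ∀ {d} → Cover k q d → h q ≤ d
  h≤ q 2≤q = cover⇒H≤ (isH q 2≤q)
  g≤4f : ∀ q → 2 ≤ q → g q ≤ f q * 4
  g≤4f q 2≤q = g≤ q 2≤q (IsF⇒cover {{ℕ.>-nonZero (ℕₚ.≤-trans (s≤s z≤n) 2≤q)}} (isF q 2≤q))
  below-g : ∀ r s → 1 ≤ s → InfBelow h r s → InfBelow g r s
  below-g r s 1≤s (q , 2≤q , gap) =
    let R , P = IsH⇒part (isH q 2≤q)
        Q , 2≤Q , D , c , gap′ = part⇒cover r s 1≤k 1≤s 2≤q P gap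
    in Q , 2≤Q , ℕₚ.≤-<-trans (ℕₚ.^-monoˡ-≤ s (g≤ Q 2≤Q c)) gap′
  below-h : ∀ r s → InfBelow g r s → InfBelow h r s
  below-h r s (q , 2≤q , gap) =
    q , 2≤q , ℕₚ.≤-<-trans (ℕₚ.^-monoˡ-≤ s (h≤ q 2≤q (cover q 2≤q))) gap
  h-atLeast : ∀ r s → 1 ≤ s → InfAtLeast g r s → InfAtLeast h r s
  h-atLeast r s 1≤s atLeast q 2≤q = ℕₚ.≮⇒≥ λ gap →
    let Q , 2≤Q , gap′ = below-g r s 1≤s (q , 2≤q , gap) in ℕₚ.<⇒≱ gap′ (atLeast Q 2≤Q)
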